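{- Let $(\mathbb{F},\sigma)$ be a difference field (i.e. $\sigma$ is an automorphism of the field $\mathbb{F}$), and let $\mathbb{F}(\alpha,\beta)$ be the field of rational functions in two algebraically independent transcendental elements $\alpha,\beta$ over $\mathbb{F}$, with $\sigma$ extended to an automorphism of $\mathbb{F}(\alpha,\beta)$ satisfying $\sigma(\alpha)=\beta$ and $\sigma(\beta)=u\alpha+v\beta$ for some $u\in\mathbb{F}\setminus\{0\}$, $v\in\mathbb{F}$. Let $g\in\mathbb{F}(\alpha,\beta)$ be nonzero and suppose $$\frac{\sigma g}{g}=\frac{p}{q},$$ where $p,q\in\mathbb{F}[\alpha,\beta]$ are polynomials with $\gcd(p,q)=1$. Then either $p,q\in\mathbb{F}$, or $\mathrm{Spr}_\sigma(p,q)\cup\mathrm{Spr}_\sigma(q,p)\neq\emptyset$.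
   Context: For nonzero $p,q\in\mathbb{F}[\alpha,\beta]$, the spread of $p$ and $q$ with respect to $\sigma$ is $\mathrm{Spr}_\sigma(p,q)=\{m\in\mathbb{N} : \deg(\gcd(p,\sigma^m q))>0\}$, where $\mathbb{N}=\{0,1,2,\dots\}$ and $\deg$ denotes total degree in $\alpha,\beta$. -}

module Defs where

open import Level using (_⊔_)
open import Algebra.Bundles using (CommutativeRing)
open import Algebra.Morphism.Structures using (module RingMorphisms)
open import Data.Nat using (ℕ; zero; suc; _<_) renaming (_+_ to _+ℕ_; _≟_ to _≟ℕ_)
open import Data.Product using (Σ; _×_; _,_)
open import Data.Sum using (_⊎_)
open import Data.List using (List; []; _∷_; _++_; concatMap; map)
open import Relation.Nullary using (¬_; yes; no)
open import Function using (_∘_)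

IsField : ∀ {c ℓ} → CommutativeRing c ℓ → Set (c ⊔ ℓ)
IsField R = ¬ (0# ≈ 1#) × (∀ x → ¬ (x ≈ 0#) → Σ Carrier λ y → x * y ≈ 1#)
  where open CommutativeRing R

IsAutomorphism : ∀ {c ℓ} (R : CommutativeRing c ℓ) →
                 (CommutativeRing.Carrier R → CommutativeRing.Carrier R) → Set (c ⊔ ℓ)
IsAutomorphism R σ = RingMorphisms.IsRingIsomorphism rawRing rawRing σ
  where open CommutativeRing R

-- Polynomials in F[α,β], represented as finite formal sums of terms
-- c · α^i · β^j, each term given as (c , i , j).
module Poly2 {c ℓ} (R : CommutativeRing c ℓ) where
  open CommutativeRing R

  Poly : Set c
  Poly = List (Carrier × ℕ × ℕ)

  coeff : Poly → ℕ → ℕ → Carrier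
  coeff [] i j = 0#
  coeff ((a , k , l) ∷ ms) i j with k ≟ℕ i | l ≟ℕ j
  ... | yes _ | yes _ = a + coeff ms i j
  ... | _     | _     = coeff ms i j

  _≃_ : Poly → Poly → Set ℓ
  p ≃ q = ∀ i j → coeff p i j ≈ coeff q i j

  0P 1P αP βP : Poly
  0P = []
  1P = (1# , 0 , 0) ∷ []
  αP = (1# , 1 , 0) ∷ []
  βP = (1# , 0 , 1) ∷ []

  constP : Carrier → Poly
  constP a = (a , 0 , 0) ∷ []

  _+P_ : Poly → Poly → Poly
  p +P q = p ++ q

  _*P_ : Poly → Poly → Poly
  p *P q = concatMap (λ { (a , i , j) → map (λ { (b , k , l) → (a * b , i +ℕ k , j +ℕ l) }) q }) p

  _^P_ : Poly → ℕ → Poly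
  p ^P zero = 1P
  p ^P suc n = p *P (p ^P n)

  IsConstant : Poly → Set ℓ
  IsConstant p = ∀ i j → 0 < i +ℕ j → coeff p i j ≈ 0#

  PosDeg : Poly → Set ℓ
  PosDeg p = Σ ℕ λ i → Σ ℕ λ j → 0 < i +ℕ j × ¬ (coeff p i j ≈ 0#)

  _∣P_ : Poly → Poly → Set (c ⊔ ℓ)
  d ∣P p = Σ Poly λ e → (d *P e) ≃ p

  IsGCD : Poly → Poly → Poly → Set (c ⊔ ℓ)
  IsGCD d p q = d ∣P p × d ∣P q × (∀ e → e ∣P p → e ∣P q → e ∣P d)

  module Shift (σ : Carrier → Carrier) (u v : Carrier) where
    σP : Poly → Poly
    σP [] = []
    σP ((a , i , j) ∷ ms) =
      (constP (σ a) *P ((βP ^P i) *P (((constP u *P αP) +P (constP v *P βP)) ^P j))) +P σP ms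

    σP^ : ℕ → Poly → Poly
    σP^ zero p = p
    σP^ (suc m) p = σP (σP^ m p)

    InSpr : Poly → Poly → ℕ → Set (c ⊔ ℓ)
    InSpr p q m = Σ Poly λ d → IsGCD d p (σP^ m q) × PosDeg d

    SprUnionNonempty : Poly → Poly → Set (c ⊔ ℓ)
    SprUnionNonempty p q = Σ ℕ λ m → InSpr p q m ⊎ InSpr q p m

{-# OPTIONS --safe #-}
module Submission where

open import Defs
open import Algebra.Bundles using (CommutativeRing)
open import Data.Product using (_×_)
open import Data.Sum using (_⊎_)
open import Relation.Nullary using (¬_)

open import Level using (_⊔_)
open import Algebra.Bundles using (CommutativeMonoid)
open import Algebra.Structures using (IsCommutativeRing)
open import Algebra.Morphism.Structures using (module RingMorphisms)
import Algebra.Morphism.Construct.Composition as Composition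
import Algebra.Morphism.Construct.Identity as Identity
open import Data.Nat as ℕ using (ℕ; zero; suc; _≤_; _<_; z≤n; s≤s)
import Data.Nat.Properties as ℕ
open import Data.Nat.Induction using (<-wellFounded)
open import Data.Product using (Σ; ∃; ∃₂; _,_; proj₁; proj₂)
open import Data.Sum using (inj₁; inj₂)
open import Data.Empty using (⊥; ⊥-elim)
open import Data.List using ([]; _∷_; _++_; map; filter; length)
open import Data.List.Properties using (++-identityʳ; ++-assoc; map-++; length-filter; filter-reject)
open import Data.List.Relation.Unary.All as All using (All; []; _∷_)
open import Data.List.Relation.Unary.All.Properties using (all-filter; ++⁺)
open import Function using (_∘_)
open import Induction.WellFounded using (Acc; acc)
open import Relation.Nullary using (Dec; yes; no; ¬?; _×-dec_; decidable-stable; ¬¬-excluded-middle)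
open import Relation.Binary.PropositionalEquality as ≡ using (_≡_; refl; cong; cong₂; subst)
open import Algebra.Properties.CommutativeSemigroup ℕ.+-commutativeSemigroup using ()
  renaming (interchange to ℕ-interchange)

-- With Pₙ = p · σp ⋯ σⁿ⁻¹p, Qₙ likewise and g = a / b, telescoping gives
-- σⁿ(a) b Qₙ = a σⁿ(b) Pₙ.  If both spreads are empty, all σⁱp and σʲq are
-- coprime, hence so are Pₙ and Qₙ, and Pₙ divides σⁿ(a) b.  The total degree of
-- σⁿ(a) b does not depend on n, whereas Pₙ has degree at least n unless p is
-- constant; the same holds for q.
--
-- Gcds in F[α,β] come from Euclid's algorithm over F[α] and Gauss's lemma: if x
-- and y have no common factor, the ideal (x, y) contains nonzero elements of
-- F[α] and of F[β].  Equality in F is neither decidable nor ¬¬-stable, so while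
-- case distinctions are made under a double negation, the cofactors required by
-- `IsGCD` are computed; these two elements of the ideal are what makes it possible.

-- Double negation does not commute with the quantifier over `e` and `f` in `Coprime`. Every case
-- distinction, such as regularity or the nonvanishing of a leading coefficient, is therefore
-- settled before `e` and `f` are given; after that the cofactor has to come from an explicit
-- computation. The tool is pseudo-division, which tests no coefficient for zero and loses nothing
-- when the divisor has a unit as leading coefficient. In one variable over F a nonzero element has
-- such a leading coefficient, which is why the ideal is asked for an element of F[β] besides the
-- one of F[α]. Degrees are compared through two measures. Upper bounds are conditions on the
-- support, preserved by σ because it sends α and β to linear forms. Lower bounds come from the
-- lexicographic leading monomial, which is multiplicative; its coefficient is nonzero, so it must
-- obey any bound on the support.

module Polynomials {c ℓ} (R : CommutativeRing c ℓ) where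
  open CommutativeRing R renaming (refl to ≈refl)
  open Poly2 R
  open import Algebra.Properties.Ring ring using (-0#≈0#; -‿+-comm)
  open import Relation.Binary.Reasoning.MultiSetoid

  -- Formal sums of terms, their coefficients and the polynomial ring.

  mono : Carrier → ℕ → ℕ → Poly
  mono a i j = (a , i , j) ∷ []

  -- Turns the case split inside `coeff` into a sum, so that later proofs can calculate with it.
  coeff-∷ : ∀ a k l p i j → coeff ((a , k , l) ∷ p) i j ≈ coeff (mono a k l) i j + coeff p i j
  coeff-∷ a k l p i j with k ℕ.≟ i | l ℕ.≟ j
  ... | yes _ | yes _ = +-congʳ (sym (+-identityʳ a))
  ... | yes _ | no _  = sym (+-identityˡ _)
  ... | no _  | _     = sym (+-identityˡ _)

  coeff-mono-≡ : ∀ a i j → coeff (mono a i j) i j ≈ a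
  coeff-mono-≡ a i j with i ℕ.≟ i | j ℕ.≟ j
  ... | yes _ | yes _ = +-identityʳ a
  ... | yes _ | no ne = ⊥-elim (ne refl)
  ... | no ne | _     = ⊥-elim (ne refl)

  coeff-mono-≢ : ∀ a k l {i j} → ¬ (k ≡ i × l ≡ j) → coeff (mono a k l) i j ≈ 0#
  coeff-mono-≢ a k l {i} {j} ne with k ℕ.≟ i | l ℕ.≟ j
  ... | yes e | yes e′ = ⊥-elim (ne (e , e′))
  ... | yes _ | no _   = ≈refl
  ... | no _  | _      = ≈refl

  coeff-mono-cong : ∀ {a b} k l i j → a ≈ b → coeff (mono a k l) i j ≈ coeff (mono b k l) i j
  coeff-mono-cong k l i j a≈b with k ℕ.≟ i | l ℕ.≟ j
  ... | yes _ | yes _ = +-congʳ a≈b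
  ... | yes _ | no _  = ≈refl
  ... | no _  | _     = ≈refl

  coeff-++ : ∀ p q i j → coeff (p ++ q) i j ≈ coeff p i j + coeff q i j
  coeff-++ [] q i j = sym (+-identityˡ _)
  coeff-++ ((a , k , l) ∷ p) q i j = begin⟨ setoid ⟩
    coeff ((a , k , l) ∷ p ++ q) i j                         ≈⟨ coeff-∷ a k l (p ++ q) i j ⟩
    coeff (mono a k l) i j + coeff (p ++ q) i j               ≈⟨ +-congˡ (coeff-++ p q i j) ⟩
    coeff (mono a k l) i j + (coeff p i j + coeff q i j)      ≈⟨ +-assoc _ _ _ ⟨
    (coeff (mono a k l) i j + coeff p i j) + coeff q i j      ≈⟨ +-congʳ (coeff-∷ a k l p i j) ⟨
    coeff ((a , k , l) ∷ p) i j + coeff q i j                ∎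

  negP : Poly → Poly
  negP = map (λ t → - proj₁ t , proj₂ t)

  coeff-neg : ∀ p i j → coeff (negP p) i j ≈ - coeff p i j
  coeff-neg [] i j = sym -0#≈0#
  coeff-neg ((a , k , l) ∷ p) i j with k ℕ.≟ i | l ℕ.≟ j
  ... | yes _ | yes _ = trans (+-congˡ (coeff-neg p i j)) (-‿+-comm a _)
  ... | yes _ | no _  = coeff-neg p i j
  ... | no _  | _     = coeff-neg p i j

  -- A polynomial with support in P may still be a list with cancelling terms
  -- outside P; `restrict` removes them.

  Region : Set₁
  Region = ℕ → ℕ → Set

  OnTerm : Region → Carrier × ℕ × ℕ → Set
  OnTerm P (_ , i , j) = P i j

  record Supp (P : Region) (p : Poly) : Set ℓ where
    constructor supp
    field off : ∀ i j → ¬ P i j → coeff p i j ≈ 0#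
  open Supp public

  module _ {P : Region} (P? : ∀ i j → Dec (P i j)) where

    restrict : Poly → Poly
    restrict = filter (λ (_ , i , j) → P? i j)

    restrict-All : ∀ p → All (OnTerm P) (restrict p)
    restrict-All = all-filter (λ (_ , i , j) → P? i j)

    coeff-restrict : ∀ p i j → P i j → coeff (restrict p) i j ≈ coeff p i j
    coeff-restrict [] i j _ = ≈refl
    coeff-restrict ((a , k , l) ∷ p) i j Pij with P? k l
    ... | yes _ = begin⟨ setoid ⟩
      coeff ((a , k , l) ∷ restrict p) i j             ≈⟨ coeff-∷ a k l _ i j ⟩
      coeff (mono a k l) i j + coeff (restrict p) i j   ≈⟨ +-congˡ (coeff-restrict p i j Pij) ⟩
      coeff (mono a k l) i j + coeff p i j              ≈⟨ coeff-∷ a k l p i j ⟨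
      coeff ((a , k , l) ∷ p) i j                      ∎
    ... | no ¬P = begin⟨ setoid ⟩
      coeff (restrict p) i j                ≈⟨ coeff-restrict p i j Pij ⟩
      coeff p i j                           ≈⟨ +-identityˡ _ ⟨
      0# + coeff p i j                      ≈⟨ +-congʳ (coeff-mono-≢ a k l λ { (refl , refl) → ¬P Pij }) ⟨
      coeff (mono a k l) i j + coeff p i j  ≈⟨ coeff-∷ a k l p i j ⟨
      coeff ((a , k , l) ∷ p) i j          ∎

  All⇒Supp : ∀ {P} p → All (OnTerm P) p → Supp P p
  All⇒Supp [] [] .off i j ¬P = ≈refl
  All⇒Supp ((a , k , l) ∷ p) (Pt ∷ Ps) .off i j ¬P =
    trans (coeff-∷ a k l p i j)
      (trans (+-cong (coeff-mono-≢ a k l λ { (refl , refl) → ¬P Pt }) (All⇒Supp p Ps .off i j ¬P))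
             (+-identityˡ 0#))

  restrict-≃ : ∀ {P} (P? : ∀ i j → Dec (P i j)) p → Supp P p → p ≃ restrict P? p
  restrict-≃ P? p sp i j with P? i j
  ... | yes Pij = sym (coeff-restrict P? p i j Pij)
  ... | no ¬Pij = trans (sp .off i j ¬Pij) (sym (All⇒Supp _ (restrict-All P? p) .off i j ¬Pij))

  ≃-refl : ∀ {p} → p ≃ p
  ≃-refl i j = ≈refl
  ≃-sym : ∀ {p q} → p ≃ q → q ≃ p
  ≃-sym e i j = sym (e i j)
  ≃-trans : ∀ {p q r} → p ≃ q → q ≃ r → p ≃ r
  ≃-trans e f i j = trans (e i j) (f i j)

  ++-cong : ∀ {p p′ q q′} → p ≃ p′ → q ≃ q′ → (p ++ q) ≃ (p′ ++ q′)
  ++-cong {p} {p′} {q} {q′} e f i j =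
    trans (coeff-++ p q i j) (trans (+-cong (e i j) (f i j)) (sym (coeff-++ p′ q′ i j)))

  ++-comm : ∀ p q → (p ++ q) ≃ (q ++ p)
  ++-comm p q i j = trans (coeff-++ p q i j) (trans (+-comm _ _) (sym (coeff-++ q p i j)))

  negP-inverseʳ : ∀ p → (p ++ negP p) ≃ []
  negP-inverseʳ p i j =
    trans (coeff-++ p (negP p) i j) (trans (+-congˡ (coeff-neg p i j)) (-‿inverseʳ _))

  -- The pattern-matching lambdas of `_*P_` cannot be named, so products are
  -- handled through this copy of multiplication by a single term.
  scale : Carrier → ℕ → ℕ → Poly → Poly
  scale a i j [] = []
  scale a i j ((b , k , l) ∷ q) = (a * b , i ℕ.+ k , j ℕ.+ l) ∷ scale a i j q

  mono-* : ∀ a i j q → mono a i j *P q ≡ scale a i j q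
  mono-* a i j [] = refl
  mono-* a i j ((b , k , l) ∷ q) = cong (_ ∷_) (mono-* a i j q)

  ∷-* : ∀ a i j p q → ((a , i , j) ∷ p) *P q ≡ scale a i j q ++ (p *P q)
  ∷-* a i j p q = cong (_++ (p *P q)) (≡.trans (≡.sym (++-identityʳ _)) (mono-* a i j q))

  scale-All : ∀ {P Q : Region} a i j q → (∀ k l → P k l → Q (i ℕ.+ k) (j ℕ.+ l)) →
              All (OnTerm P) q → All (OnTerm Q) (scale a i j q)
  scale-All a i j [] f [] = []
  scale-All a i j ((b , k , l) ∷ q) f (Pt ∷ Ps) = f k l Pt ∷ scale-All a i j q f Ps

  *-All : ∀ {P Q W : Region} → (∀ {i j k l} → P i j → Q k l → W (i ℕ.+ k) (j ℕ.+ l)) →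
          ∀ p q → All (OnTerm P) p → All (OnTerm Q) q → All (OnTerm W) (p *P q)
  *-All f [] q [] Qs = []
  *-All {P} {Q} {W} f ((a , i , j) ∷ p) q (Pt ∷ Ps) Qs =
    subst (All (OnTerm W)) (≡.sym (∷-* a i j p q))
      (++⁺ (scale-All a i j q (λ k l → f Pt) Qs) (*-All f p q Ps Qs))

  -- Two formal sums are equal as polynomials exactly when all the functionals
  -- ⟨_, φ⟩ (for h = id) agree on them; this is how the ring laws are proved.
  module Functional {c′ ℓ′} (S : CommutativeRing c′ ℓ′)
    {h : Carrier → CommutativeRing.Carrier S}
    (hom : RingMorphisms.IsRingHomomorphism rawRing (CommutativeRing.rawRing S) h) where
    private module S = CommutativeRing S
    open RingMorphisms.IsRingHomomorphism hom using (⟦⟧-cong; +-homo; *-homo; 0#-homo)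
    open import Algebra.Properties.Ring S.ring using ()
      renaming (-0#≈0# to -0≈0; -‿+-comm to neg-+; -‿distribˡ-* to neg-*)
    open import Algebra.Properties.CommutativeSemigroup (CommutativeMonoid.commutativeSemigroup S.+-commutativeMonoid)
      using (interchange)

    ⟨_,_⟩ : Poly → (ℕ → ℕ → S.Carrier) → S.Carrier
    ⟨ [] , φ ⟩ = S.0#
    ⟨ (a , i , j) ∷ p , φ ⟩ = h a S.* φ i j S.+ ⟨ p , φ ⟩

    ⟨⟩-congʳ : ∀ p {φ ψ} → (∀ i j → φ i j S.≈ ψ i j) → ⟨ p , φ ⟩ S.≈ ⟨ p , ψ ⟩
    ⟨⟩-congʳ [] e = S.refl
    ⟨⟩-congʳ ((a , i , j) ∷ p) e = S.+-cong (S.*-congˡ (e i j)) (⟨⟩-congʳ p e)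

    ⟨⟩-++ : ∀ p q φ → ⟨ p ++ q , φ ⟩ S.≈ ⟨ p , φ ⟩ S.+ ⟨ q , φ ⟩
    ⟨⟩-++ [] q φ = S.sym (S.+-identityˡ _)
    ⟨⟩-++ ((a , i , j) ∷ p) q φ = S.trans (S.+-congˡ (⟨⟩-++ p q φ)) (S.sym (S.+-assoc _ _ _))

    ⟨⟩-0 : ∀ p → ⟨ p , (λ _ _ → S.0#) ⟩ S.≈ S.0#
    ⟨⟩-0 [] = S.refl
    ⟨⟩-0 (_ ∷ p) = S.trans (S.+-cong (S.zeroʳ _) (⟨⟩-0 p)) (S.+-identityˡ _)

    ⟨⟩-+ʳ : ∀ p φ ψ → ⟨ p , (λ i j → φ i j S.+ ψ i j) ⟩ S.≈ ⟨ p , φ ⟩ S.+ ⟨ p , ψ ⟩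
    ⟨⟩-+ʳ [] φ ψ = S.sym (S.+-identityˡ _)
    ⟨⟩-+ʳ ((a , i , j) ∷ p) φ ψ =
      S.trans (S.+-cong (S.distribˡ _ _ _) (⟨⟩-+ʳ p φ ψ)) (interchange _ _ _ _)

    ⟨⟩-*ʳ : ∀ p φ x → ⟨ p , (λ i j → φ i j S.* x) ⟩ S.≈ ⟨ p , φ ⟩ S.* x
    ⟨⟩-*ʳ [] φ x = S.sym (S.zeroˡ x)
    ⟨⟩-*ʳ ((a , i , j) ∷ p) φ x =
      S.trans (S.+-cong (S.sym (S.*-assoc _ _ _)) (⟨⟩-*ʳ p φ x)) (S.sym (S.distribʳ _ _ _))

    ⟨⟩-neg : ∀ p φ → ⟨ negP p , φ ⟩ S.≈ S.- ⟨ p , φ ⟩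
    ⟨⟩-neg [] φ = S.sym -0≈0
    ⟨⟩-neg ((a , i , j) ∷ p) φ = S.trans
      (S.+-cong (S.trans (S.*-congʳ (RingMorphisms.IsRingHomomorphism.-‿homo hom a)) (S.sym (neg-* _ _))) (⟨⟩-neg p φ))
      (neg-+ _ _)

    ⟨⟩-Fubini : ∀ p q (f : ℕ → ℕ → ℕ → ℕ → S.Carrier) →
      ⟨ p , (λ i j → ⟨ q , f i j ⟩) ⟩ S.≈ ⟨ q , (λ k l → ⟨ p , (λ i j → f i j k l) ⟩) ⟩
    ⟨⟩-Fubini [] q f = S.sym (⟨⟩-0 q)
    ⟨⟩-Fubini ((a , i , j) ∷ p) q f = begin⟨ S.setoid ⟩
      h a S.* ⟨ q , f i j ⟩ S.+ ⟨ p , (λ i j → ⟨ q , f i j ⟩) ⟩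
        ≈⟨ S.+-cong (S.trans (S.*-comm _ _) (S.sym (⟨⟩-*ʳ q (f i j) (h a)))) (⟨⟩-Fubini p q f) ⟩
      ⟨ q , (λ k l → f i j k l S.* h a) ⟩ S.+ ⟨ q , (λ k l → ⟨ p , (λ i j → f i j k l) ⟩) ⟩
        ≈⟨ ⟨⟩-+ʳ q _ _ ⟨
      ⟨ q , (λ k l → f i j k l S.* h a S.+ ⟨ p , (λ i j → f i j k l) ⟩) ⟩
        ≈⟨ ⟨⟩-congʳ q (λ k l → S.+-congʳ (S.*-comm _ _)) ⟩
      ⟨ q , (λ k l → h a S.* f i j k l S.+ ⟨ p , (λ i j → f i j k l) ⟩) ⟩ ∎

    private
      remove? : ∀ i j k l → Dec (¬ (k ≡ i × l ≡ j))
      remove? i j k l = ¬? ((k ℕ.≟ i) ×-dec (l ℕ.≟ j))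

      extract : ∀ i j (P? : ∀ k l → Dec (¬ (k ≡ i × l ≡ j))) p φ →
                ⟨ p , φ ⟩ S.≈ h (coeff p i j) S.* φ i j S.+ ⟨ restrict P? p , φ ⟩
      extract i j P? [] φ = S.sym (S.trans (S.+-identityʳ _) (S.trans (S.*-congʳ 0#-homo) (S.zeroˡ _)))
      extract i j P? ((a , k , l) ∷ p) φ with P? k l
      ... | yes ne = begin⟨ S.setoid ⟩
        h a S.* φ k l S.+ ⟨ p , φ ⟩
          ≈⟨ S.+-congˡ (extract i j P? p φ) ⟩
        h a S.* φ k l S.+ (h (coeff p i j) S.* φ i j S.+ ⟨ restrict P? p , φ ⟩)
          ≈⟨ S.trans (S.sym (S.+-assoc _ _ _)) (S.trans (S.+-congʳ (S.+-comm _ _)) (S.+-assoc _ _ _)) ⟩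
        h (coeff p i j) S.* φ i j S.+ (h a S.* φ k l S.+ ⟨ restrict P? p , φ ⟩)
          ≈⟨ S.+-congʳ (S.*-congʳ (⟦⟧-cong (trans (coeff-∷ a k l p i j)
               (trans (+-congʳ (coeff-mono-≢ a k l ne)) (+-identityˡ _))))) ⟨
        h (coeff ((a , k , l) ∷ p) i j) S.* φ i j S.+ (h a S.* φ k l S.+ ⟨ restrict P? p , φ ⟩) ∎
      ... | no ¬ne with decidable-stable ((k ℕ.≟ i) ×-dec (l ℕ.≟ j)) ¬ne
      ...   | refl , refl = begin⟨ S.setoid ⟩
        h a S.* φ k l S.+ ⟨ p , φ ⟩
          ≈⟨ S.+-congˡ (extract i j P? p φ) ⟩
        h a S.* φ k l S.+ (h (coeff p k l) S.* φ k l S.+ ⟨ restrict P? p , φ ⟩)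
          ≈⟨ S.+-assoc _ _ _ ⟨
        (h a S.* φ k l S.+ h (coeff p k l) S.* φ k l) S.+ ⟨ restrict P? p , φ ⟩
          ≈⟨ S.+-congʳ (S.distribʳ _ _ _) ⟨
        (h a S.+ h (coeff p k l)) S.* φ k l S.+ ⟨ restrict P? p , φ ⟩
          ≈⟨ S.+-congʳ (S.*-congʳ (S.trans (⟦⟧-cong (trans (coeff-∷ a k l p k l) (+-congʳ (coeff-mono-≡ a k l)))) (+-homo _ _))) ⟨
        h (coeff ((a , k , l) ∷ p) k l) S.* φ k l S.+ ⟨ restrict P? p , φ ⟩ ∎

      -- The head may cancel against later terms, so `p ≃ []` does not pass to the tail. All terms
      -- with the exponents of the head are gathered by `extract`; the rest is a shorter list that
      -- still represents zero, hence the induction on length.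
      vanish : ∀ p φ → Acc _<_ (length p) → p ≃ [] → ⟨ p , φ ⟩ S.≈ S.0#
      vanish [] φ _ _ = S.refl
      vanish p@((a , i , j) ∷ p′) φ (acc rec) p≃0 = begin⟨ S.setoid ⟩
        ⟨ p , φ ⟩
          ≈⟨ extract i j (remove? i j) p φ ⟩
        h (coeff p i j) S.* φ i j S.+ ⟨ restrict (remove? i j) p , φ ⟩
          ≈⟨ S.+-cong (S.trans (S.*-congʳ (S.trans (⟦⟧-cong (p≃0 i j)) 0#-homo)) (S.zeroˡ _))
                      (vanish (restrict (remove? i j) p) φ (rec shorter) rest≃0) ⟩
        S.0# S.+ S.0#
          ≈⟨ S.+-identityˡ _ ⟩
        S.0# ∎
        where
        shorter : length (restrict (remove? i j) p) < length p
        shorter = subst (λ r → length r < length p)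
          (≡.sym (filter-reject (λ (_ , k , l) → remove? i j k l) {a , i , j} {p′} (λ ne → ne (refl , refl))))
          (s≤s (length-filter (λ (_ , k , l) → remove? i j k l) p′))
        rest≃0 : restrict (remove? i j) p ≃ []
        rest≃0 k l with remove? i j k l
        ... | yes P = trans (coeff-restrict (remove? i j) p k l P) (p≃0 k l)
        ... | no ¬P = All⇒Supp _ (restrict-All (remove? i j) p) .off k l ¬P

    -- With the polynomial ring as `S`, this is what makes substitution of polynomials for α and β,
    -- and thereby `σP`, respect `_≃_`.
    ⟨⟩-congˡ : ∀ p q φ → p ≃ q → ⟨ p , φ ⟩ S.≈ ⟨ q , φ ⟩
    ⟨⟩-congˡ p q φ p≃q = begin⟨ S.setoid ⟩
      ⟨ p , φ ⟩                                   ≈⟨ S.+-identityʳ _ ⟨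
      ⟨ p , φ ⟩ S.+ S.0#                          ≈⟨ S.+-congˡ (S.-‿inverseˡ _) ⟨
      ⟨ p , φ ⟩ S.+ (S.- ⟨ q , φ ⟩ S.+ ⟨ q , φ ⟩) ≈⟨ S.+-assoc _ _ _ ⟨
      (⟨ p , φ ⟩ S.+ S.- ⟨ q , φ ⟩) S.+ ⟨ q , φ ⟩ ≈⟨ S.+-congʳ (S.trans (⟨⟩-++ p (negP q) φ) (S.+-congˡ (⟨⟩-neg q φ))) ⟨
      ⟨ p ++ negP q , φ ⟩ S.+ ⟨ q , φ ⟩           ≈⟨ S.+-congʳ (vanish (p ++ negP q) φ (<-wellFounded _) p-q≃0) ⟩
      S.0# S.+ ⟨ q , φ ⟩                          ≈⟨ S.+-identityˡ _ ⟩
      ⟨ q , φ ⟩                                   ∎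
      where
      p-q≃0 : (p ++ negP q) ≃ []
      p-q≃0 = ≃-trans {p ++ negP q} {q ++ negP q} {[]} (++-cong {p} {q} {negP q} p≃q (≃-refl {negP q})) (negP-inverseʳ q)

    ⟨⟩-scale : ∀ a i j q φ →
      ⟨ scale a i j q , φ ⟩ S.≈ h a S.* ⟨ q , (λ k l → φ (i ℕ.+ k) (j ℕ.+ l)) ⟩
    ⟨⟩-scale a i j [] φ = S.sym (S.zeroʳ _)
    ⟨⟩-scale a i j ((b , k , l) ∷ q) φ = S.trans
      (S.+-cong (S.trans (S.*-congʳ (*-homo a b)) (S.*-assoc _ _ _)) (⟨⟩-scale a i j q φ))
      (S.sym (S.distribˡ _ _ _))

    ⟨⟩-* : ∀ p q φ →
      ⟨ p *P q , φ ⟩ S.≈ ⟨ p , (λ i j → ⟨ q , (λ k l → φ (i ℕ.+ k) (j ℕ.+ l)) ⟩) ⟩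
    ⟨⟩-* [] q φ = S.refl
    ⟨⟩-* ((a , i , j) ∷ p) q φ = begin⟨ S.setoid ⟩
      ⟨ ((a , i , j) ∷ p) *P q , φ ⟩                 ≈⟨ S.reflexive (cong (λ r → ⟨ r , φ ⟩) (∷-* a i j p q)) ⟩
      ⟨ scale a i j q ++ (p *P q) , φ ⟩              ≈⟨ ⟨⟩-++ (scale a i j q) (p *P q) φ ⟩
      ⟨ scale a i j q , φ ⟩ S.+ ⟨ p *P q , φ ⟩       ≈⟨ S.+-cong (⟨⟩-scale a i j q φ) (⟨⟩-* p q φ) ⟩
      _                                              ∎

    -- The hypothesis makes `φ` multiplicative on the monoid of exponents; its main instance sends
    -- `i` and `j` to `x ^ i * y ^ j`.
    ⟨⟩-*-homo : ∀ {φ} → (∀ i j k l → φ (i ℕ.+ k) (j ℕ.+ l) S.≈ φ i j S.* φ k l) →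
      ∀ p q → ⟨ p *P q , φ ⟩ S.≈ ⟨ p , φ ⟩ S.* ⟨ q , φ ⟩
    ⟨⟩-*-homo {φ} φ-* p q = begin⟨ S.setoid ⟩
      ⟨ p *P q , φ ⟩
        ≈⟨ ⟨⟩-* p q φ ⟩
      ⟨ p , (λ i j → ⟨ q , (λ k l → φ (i ℕ.+ k) (j ℕ.+ l)) ⟩) ⟩
        ≈⟨ ⟨⟩-congʳ p (λ i j → ⟨⟩-congʳ q (λ k l → S.trans (φ-* i j k l) (S.*-comm _ _))) ⟩
      ⟨ p , (λ i j → ⟨ q , (λ k l → φ k l S.* φ i j) ⟩) ⟩
        ≈⟨ ⟨⟩-congʳ p (λ i j → S.trans (⟨⟩-*ʳ q φ (φ i j)) (S.*-comm _ _)) ⟩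
      ⟨ p , (λ i j → φ i j S.* ⟨ q , φ ⟩) ⟩
        ≈⟨ ⟨⟩-*ʳ p φ ⟨ q , φ ⟩ ⟩
      ⟨ p , φ ⟩ S.* ⟨ q , φ ⟩ ∎

  private
    module Id where
      open Functional R (Identity.isRingHomomorphism rawRing ≈refl) public
  open Id using (⟨_,_⟩)

  -- Taking a coefficient is itself a functional, given by the indicator of `(i , j)`; hence the
  -- functionals separate polynomials.
  coeff-⟨⟩ : ∀ p i j → coeff p i j ≈ ⟨ p , (λ k l → coeff (mono 1# k l) i j) ⟩
  coeff-⟨⟩ [] i j = ≈refl
  coeff-⟨⟩ ((a , k , l) ∷ p) i j = trans (coeff-∷ a k l p i j) (+-cong scaled (coeff-⟨⟩ p i j))
    where
    scaled : coeff (mono a k l) i j ≈ a * coeff (mono 1# k l) i j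
    scaled with k ℕ.≟ i | l ℕ.≟ j
    ... | yes _ | yes _ = trans (+-identityʳ a) (sym (trans (*-congˡ (+-identityʳ 1#)) (*-identityʳ a)))
    ... | yes _ | no _  = sym (zeroʳ a)
    ... | no _  | _     = sym (zeroʳ a)

  ⟨⟩⇒≃ : ∀ p q → (∀ φ → ⟨ p , φ ⟩ ≈ ⟨ q , φ ⟩) → p ≃ q
  ⟨⟩⇒≃ p q e i j = trans (coeff-⟨⟩ p i j) (trans (e _) (sym (coeff-⟨⟩ q i j)))

  *P-cong : ∀ {p p′ q q′} → p ≃ p′ → q ≃ q′ → (p *P q) ≃ (p′ *P q′)
  *P-cong {p} {p′} {q} {q′} e f = ⟨⟩⇒≃ (p *P q) (p′ *P q′) λ φ →
    trans (Id.⟨⟩-* p q φ) (trans (Id.⟨⟩-congˡ p p′ _ e)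
      (trans (Id.⟨⟩-congʳ p′ (λ i j → Id.⟨⟩-congˡ q q′ _ f)) (sym (Id.⟨⟩-* p′ q′ φ))))

  *P-comm : ∀ p q → (p *P q) ≃ (q *P p)
  *P-comm p q = ⟨⟩⇒≃ (p *P q) (q *P p) λ φ → begin⟨ setoid ⟩
    ⟨ p *P q , φ ⟩                                              ≈⟨ Id.⟨⟩-* p q φ ⟩
    ⟨ p , (λ i j → ⟨ q , (λ k l → φ (i ℕ.+ k) (j ℕ.+ l)) ⟩) ⟩  ≈⟨ Id.⟨⟩-Fubini p q _ ⟩
    ⟨ q , (λ k l → ⟨ p , (λ i j → φ (i ℕ.+ k) (j ℕ.+ l)) ⟩) ⟩
      ≈⟨ Id.⟨⟩-congʳ q (λ k l → Id.⟨⟩-congʳ p (λ i j → reflexive (cong₂ φ (ℕ.+-comm i k) (ℕ.+-comm j l)))) ⟩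
    ⟨ q , (λ k l → ⟨ p , (λ i j → φ (k ℕ.+ i) (l ℕ.+ j)) ⟩) ⟩  ≈⟨ Id.⟨⟩-* q p φ ⟨
    ⟨ q *P p , φ ⟩                                              ∎

  *P-assoc : ∀ p q r → ((p *P q) *P r) ≃ (p *P (q *P r))
  *P-assoc p q r = ⟨⟩⇒≃ ((p *P q) *P r) (p *P (q *P r)) λ φ → begin⟨ setoid ⟩
    ⟨ (p *P q) *P r , φ ⟩
      ≈⟨ trans (Id.⟨⟩-* (p *P q) r φ) (Id.⟨⟩-* p q _) ⟩
    ⟨ p , (λ i j → ⟨ q , (λ k l → ⟨ r , (λ m n → φ ((i ℕ.+ k) ℕ.+ m) ((j ℕ.+ l) ℕ.+ n)) ⟩) ⟩) ⟩
      ≈⟨ Id.⟨⟩-congʳ p (λ i j → Id.⟨⟩-congʳ q (λ k l → Id.⟨⟩-congʳ r (λ m n →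
           reflexive (cong₂ φ (ℕ.+-assoc i k m) (ℕ.+-assoc j l n))))) ⟩
    ⟨ p , (λ i j → ⟨ q , (λ k l → ⟨ r , (λ m n → φ (i ℕ.+ (k ℕ.+ m)) (j ℕ.+ (l ℕ.+ n))) ⟩) ⟩) ⟩
      ≈⟨ trans (Id.⟨⟩-* p (q *P r) φ) (Id.⟨⟩-congʳ p (λ i j → Id.⟨⟩-* q r _)) ⟨
    ⟨ p *P (q *P r) , φ ⟩ ∎

  *P-identityˡ : ∀ p → (1P *P p) ≃ p
  *P-identityˡ p = ⟨⟩⇒≃ (1P *P p) p λ φ →
    trans (Id.⟨⟩-* 1P p φ) (trans (+-identityʳ _) (*-identityˡ _))

  *P-distribʳ : ∀ r p q → ((p ++ q) *P r) ≃ ((p *P r) ++ (q *P r))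
  *P-distribʳ r p q = ⟨⟩⇒≃ ((p ++ q) *P r) ((p *P r) ++ (q *P r)) λ φ →
    trans (Id.⟨⟩-* (p ++ q) r φ) (trans (Id.⟨⟩-++ p q _)
      (sym (trans (Id.⟨⟩-++ (p *P r) (q *P r) φ) (+-cong (Id.⟨⟩-* p r φ) (Id.⟨⟩-* q r φ)))))

  -- Wrapping `_≃_` in a record lets both sides be inferred from a proof.
  infix 4 _≋_
  record _≋_ (p q : Poly) : Set ℓ where
    constructor coeffwise
    field at : p ≃ q
  open _≋_ public

  -- Opaque copies of the operations keep the unifier from unfolding them.
  infixl 7 _·_
  infixl 6 _⊕_
  opaque
    _⊕_ _·_ : Poly → Poly → Poly
    p ⊕ q = p +P q
    p · q = p *P q

    ⊖_ : Poly → Poly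
    ⊖ p = negP p

  opaque
    unfolding _⊕_

    ⊕≡ : ∀ p q → p ⊕ q ≡ p +P q
    ⊕≡ p q = refl

    ·≡ : ∀ p q → p · q ≡ p *P q
    ·≡ p q = refl

    coeff-⊕ : ∀ p q i j → coeff (p ⊕ q) i j ≈ coeff p i j + coeff q i j
    coeff-⊕ = coeff-++

    coeff-⊖ : ∀ p i j → coeff (⊖ p) i j ≈ - coeff p i j
    coeff-⊖ = coeff-neg

    isCommutativeRingP : IsCommutativeRing _≋_ _⊕_ _·_ ⊖_ 0P 1P
    isCommutativeRingP = record
      { isRing = record
        { +-isAbelianGroup = record
          { isGroup = record
            { isMonoid = record
              { isSemigroup = record
                { isMagma = record
                  { isEquivalence = record
                    { refl = λ {p} → coeffwise (≃-refl {p})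
                    ; sym = λ {p} {q} e → coeffwise (≃-sym {p} {q} (e .at))
                    ; trans = λ {p} {q} {r} e f → coeffwise (≃-trans {p} {q} {r} (e .at) (f .at)) }
                  ; ∙-cong = λ {p} {q} {r} {s} e f → coeffwise (++-cong {p} {q} {r} {s} (e .at) (f .at)) }
                ; assoc = λ p q r → ≡⇒≋ (++-assoc p q r) }
              ; identity = (λ p → ≡⇒≋ refl) , λ p → ≡⇒≋ (++-identityʳ p) }
            ; inverse = (λ p → coeffwise (≃-trans {negP p ++ p} {p ++ negP p} {[]} (++-comm (negP p) p) (negP-inverseʳ p)))
                      , λ p → coeffwise (negP-inverseʳ p)
            ; ⁻¹-cong = λ {p} {q} e → coeffwise λ i j →
                trans (coeff-neg p i j) (trans (-‿cong (e .at i j)) (sym (coeff-neg q i j))) }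
          ; comm = λ p q → coeffwise (++-comm p q) }
        ; *-cong = λ {p} {q} {r} {s} e f → coeffwise (*P-cong {p} {q} {r} {s} (e .at) (f .at))
        ; *-assoc = λ p q r → coeffwise (*P-assoc p q r)
        ; *-identity = (λ p → coeffwise (*P-identityˡ p))
                     , λ p → coeffwise (≃-trans {p *P 1P} {1P *P p} {p} (*P-comm p 1P) (*P-identityˡ p))
        ; distrib = (λ r p q → coeffwise (≃-trans {r *P (p ++ q)} {(p ++ q) *P r} {(r *P p) ++ (r *P q)} (*P-comm r (p ++ q))
                       (≃-trans {(p ++ q) *P r} {(p *P r) ++ (q *P r)} {(r *P p) ++ (r *P q)} (*P-distribʳ r p q)
                         (++-cong {p *P r} {r *P p} {q *P r} {r *P q} (*P-comm p r) (*P-comm q r)))))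
                  , λ r p q → coeffwise (*P-distribʳ r p q) }
      ; *-comm = λ p q → coeffwise (*P-comm p q) }
      where
      ≡⇒≋ : ∀ {p q} → p ≡ q → p ≋ q
      ≡⇒≋ refl = coeffwise (λ _ _ → ≈refl)

  polyRing : CommutativeRing c ℓ
  polyRing = record { isCommutativeRing = isCommutativeRingP }

infixl 1 _>>=_

_>>=_ : ∀ {a b} {A : Set a} {B : Set b} → ¬ ¬ A → (A → ¬ ¬ B) → ¬ ¬ B
(m >>= f) k = m λ a → f a k

return : ∀ {a} {A : Set a} → A → ¬ ¬ A
return a k = k a

-- Divisibility, regular elements and coprimality in a commutative ring.

module Domains {c ℓ} (S : CommutativeRing c ℓ) where
  open CommutativeRing S hiding (_≉_) renaming (refl to ≈refl)
  open import Algebra.Solver.Ring.NaturalCoefficients.Default commutativeSemiring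
    using (solve; _:=_; _:+_; _:*_)
  open import Algebra.Properties.Semiring.Exp (CommutativeRing.semiring S) using (_^_; ^-homo-*; ^-congʳ)
  open import Algebra.Properties.Ring (CommutativeRing.ring S) using (-‿distribˡ-*; -‿distribʳ-*)
  open import Relation.Binary.Reasoning.Setoid setoid

  infix 4 _∣_ _≉_

  _≉_ : Carrier → Carrier → Set ℓ
  x ≉ y = ¬ x ≈ y

  _∣_ : Carrier → Carrier → Set (c ⊔ ℓ)
  d ∣ p = ∃ λ e → d * e ≈ p

  -- Nonzero elements turn out to be regular only up to double negation, so arguments that must
  -- return data take regularity as their hypothesis.
  Regular : Carrier → Set (c ⊔ ℓ)
  Regular x = ∀ z → x * z ≈ 0# → z ≈ 0#

  Unit : Carrier → Set (c ⊔ ℓ)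
  Unit x = ∃ λ y → x * y ≈ 1#

  -- In a UFD this says that x and y have no common factor.  It is preserved
  -- by products and by automorphisms for purely formal reasons.
  Coprime : Carrier → Carrier → Set (c ⊔ ℓ)
  Coprime x y = ∀ e f → x * f ≈ y * e → x ∣ e

  move : ∀ {x y z} → x ≈ y + z → z ≈ x + - y
  move {x} {y} {z} e = sym (begin
    x + - y          ≈⟨ +-congʳ e ⟩
    (y + z) + - y    ≈⟨ swap y z (- y) ⟩
    z + (y + - y)    ≈⟨ +-congˡ (-‿inverseʳ y) ⟩
    z + 0#           ≈⟨ +-identityʳ z ⟩
    z                ∎)
    where
    swap = solve 3 (λ a b d → (a :+ b) :+ d := b :+ (a :+ d)) ≈refl

  unmove : ∀ {x y} → x + - y ≈ 0# → x ≈ y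
  unmove {x} {y} e = begin
    x              ≈⟨ +-identityʳ x ⟨
    x + 0#         ≈⟨ +-congˡ (-‿inverseˡ y) ⟨
    x + (- y + y)  ≈⟨ +-assoc x (- y) y ⟨
    (x + - y) + y  ≈⟨ +-congʳ e ⟩
    0# + y         ≈⟨ +-identityˡ y ⟩
    y              ∎

  transpose : ∀ {x y z w} → x + y ≈ z + w → x + - z ≈ w + - y
  transpose {x} {y} {z} {w} e = begin
    x + - z                  ≈⟨ +-congʳ (move (trans (sym e) (+-comm x y))) ⟩
    ((z + w) + - y) + - z    ≈⟨ regroup z w (- y) (- z) ⟩
    (z + - z) + (w + - y)    ≈⟨ +-congʳ (-‿inverseʳ z) ⟩
    0# + (w + - y)           ≈⟨ +-identityˡ _ ⟩
    w + - y                  ∎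
    where
    regroup = solve 4 (λ z w y v → ((z :+ w) :+ y) :+ v := (z :+ v) :+ (w :+ y)) ≈refl

  cancel : ∀ {x y z} → Regular x → x * y ≈ x * z → y ≈ z
  cancel {x} {y} {z} reg e = unmove (reg (y + - z) (begin
    x * (y + - z)        ≈⟨ distribˡ x y (- z) ⟩
    x * y + x * - z      ≈⟨ +-cong e (sym (-‿distribʳ-* x z)) ⟩
    x * z + - (x * z)    ≈⟨ -‿inverseʳ _ ⟩
    0#                   ∎))

  ∣-trans : ∀ {x y z} → x ∣ y → y ∣ z → x ∣ z
  ∣-trans (e , xe≈y) (f , yf≈z) = e * f , trans (sym (*-assoc _ e f)) (trans (*-congʳ xe≈y) yf≈z)

  ∣-+ : ∀ {x y z} → x ∣ y → x ∣ z → x ∣ y + z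
  ∣-+ (e , p) (f , q) = e + f , trans (distribˡ _ e f) (+-cong p q)

  ∣-* : ∀ {x y} z → x ∣ y → x ∣ y * z
  ∣-* z (e , p) = e * z , trans (sym (*-assoc _ e z)) (*-congʳ p)

  ∣-neg : ∀ {x y} → x ∣ y → x ∣ - y
  ∣-neg (e , p) = - e , trans (sym (-‿distribʳ-* _ e)) (-‿cong p)

  ∣-resp : ∀ {x y z} → y ≈ z → x ∣ y → x ∣ z
  ∣-resp y≈z (e , p) = e , trans p y≈z

  ∣-0 : ∀ {x y} → y ≈ 0# → x ∣ y
  ∣-0 y≈0 = 0# , trans (zeroʳ _) (sym y≈0)

  unit-^ : ∀ {x} → Unit x → ∀ n → Unit (x ^ n)
  unit-^ _ zero = 1# , *-identityˡ 1#
  unit-^ u@(y , xy≈1) (suc n) with unit-^ u n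
  ... | z , xⁿz≈1 = y * z , trans (regroup _ _ y z) (trans (*-cong xy≈1 xⁿz≈1) (*-identityˡ 1#))
    where
    regroup = solve 4 (λ a b y z → (a :* b) :* (y :* z) := (a :* y) :* (b :* z)) ≈refl

  unit-regular : ∀ {x} → Unit x → Regular x
  unit-regular {x} (y , xy≈1) z xz≈0 = begin
    z            ≈⟨ *-identityˡ z ⟨
    1# * z       ≈⟨ *-congʳ xy≈1 ⟨
    (x * y) * z  ≈⟨ regroup x y z ⟩
    y * (x * z)  ≈⟨ *-congˡ xz≈0 ⟩
    y * 0#       ≈⟨ zeroʳ y ⟩
    0#           ∎
    where
    regroup = solve 3 (λ x y z → (x :* y) :* z := y :* (x :* z)) ≈refl

  unit-∣ : ∀ {x y z} → Unit x → x * y ≈ z → z ∣ y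
  unit-∣ {x} {y} {z} (x⁻¹ , e) xy≈z = x⁻¹ , (begin
    z * x⁻¹        ≈⟨ *-congʳ xy≈z ⟨
    (x * y) * x⁻¹  ≈⟨ regroup x y x⁻¹ ⟩
    (x * x⁻¹) * y  ≈⟨ *-congʳ e ⟩
    1# * y         ≈⟨ *-identityˡ y ⟩
    y              ∎)
    where
    regroup = solve 3 (λ x y z → (x :* y) :* z := (x :* z) :* y) ≈refl

  factor≉0ˡ : ∀ {x y z} → x * y ≈ z → z ≉ 0# → x ≉ 0#
  factor≉0ˡ xy≈z z≉0 x≈0 = z≉0 (trans (sym xy≈z) (trans (*-congʳ x≈0) (zeroˡ _)))

  factor≉0ʳ : ∀ {x y z} → x * y ≈ z → z ≉ 0# → y ≉ 0#
  factor≉0ʳ xy≈z = factor≉0ˡ (trans (*-comm _ _) xy≈z)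

  -- No factorization enters: the equation obtained from coprimality to `y` is the one that
  -- coprimality to `z` consumes.
  coprime-*ʳ : ∀ {x y z} → Coprime x y → Coprime x z → Coprime x (y * z)
  coprime-*ʳ {x} {y} {z} xy xz e f xf≈yze with xy (z * e) f (trans xf≈yze (*-assoc y z e))
  ... | w , xw≈ze = xz e w xw≈ze

  coprime-1ʳ : ∀ {x} → Coprime x 1#
  coprime-1ʳ e f xf≈e = f , trans xf≈e (*-identityˡ e)

  coprime-sym : ∀ {x y} → Regular x → Coprime x y → Coprime y x
  coprime-sym {x} {y} reg xy e f yf≈xe with xy f e (sym yf≈xe)
  ... | z , xz≈f = z , cancel reg (begin
    x * (y * z)  ≈⟨ regroup x y z ⟩
    y * (x * z)  ≈⟨ *-congˡ xz≈f ⟩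
    y * f        ≈⟨ yf≈xe ⟩
    x * e        ∎)
    where
    regroup = solve 3 (λ x y z → x :* (y :* z) := y :* (x :* z)) ≈refl

  coprime-associate : ∀ {d x y p q} → Unit d → p ≈ d * x → q ≈ d * y → Coprime x y → Coprime p q
  coprime-associate {d} {x} {y} {p} {q} u p≈dx q≈dy xy e f pf≈qe =
    ∣-trans (unit-∣ u (sym p≈dx)) (xy e f (cancel (unit-regular u) (begin
      d * (x * f)  ≈⟨ *-assoc d x f ⟨
      (d * x) * f  ≈⟨ *-congʳ p≈dx ⟨
      p * f        ≈⟨ pf≈qe ⟩
      q * e        ≈⟨ *-congʳ q≈dy ⟩
      (d * y) * e  ≈⟨ *-assoc d y e ⟩
      d * (y * e)  ∎)))

  -- D n is the set of polynomials of degree < n in the variable X over the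
  -- coefficient ring D 1.
  record Filtration (D : ℕ → Carrier → Set ℓ) (X : Carrier) : Set (c ⊔ ℓ) where
    field
      D-resp : ∀ {n p q} → p ≈ q → D n p → D n q
      D-+    : ∀ {n p q} → D n p → D n q → D n (p + q)
      D-neg  : ∀ {n p} → D n p → D n (- p)
      D-≤    : ∀ {m n p} → m ≤ n → D m p → D n p
      D-0    : ∀ {p} → D 0 p → p ≈ 0#
      D-0#   : D 0 0#
      D-1    : D 1 1#
      D-X    : D 2 X
      -- Degree below `m` times degree at most `n`. The asymmetry avoids a predecessor in the strict
      -- bounds and covers `m = 0`, where `p` vanishes.
      D-*    : ∀ {m n p q} → D m p → D (suc n) q → D (m ℕ.+ n) (p * q)
      split  : ∀ {n p} → D (suc n) p → ∃₂ λ p′ a → D n p′ × D 1 a × p ≈ p′ + a * X ^ n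
      indep  : ∀ {n p a} → D n p → D 1 a → p ≈ a * X ^ n → a ≈ 0#

    -- Leading coefficients, pseudo-division and Euclid's algorithm.

    D-K* : ∀ {n a p} → D 1 a → D n p → D n (a * p)
    D-K* {n} Da Dp = D-resp (*-comm _ _) (subst (λ m → D m _) (ℕ.+-identityʳ n) (D-* Dp Da))

    D-X^ : ∀ n → D (suc n) (X ^ n)
    D-X^ zero = D-1
    D-X^ (suc n) = D-* D-X (D-X^ n)

    D-*X^ : ∀ {m p} n → D m p → D (m ℕ.+ n) (p * X ^ n)
    D-*X^ n Dp = D-* Dp (D-X^ n)

    -- The coefficient `a` may be zero, so `n` only bounds the degree; this lets `split-lead`
    -- produce it without any decision.
    Lead : Carrier → ℕ → Carrier → Set (c ⊔ ℓ)
    Lead p n a = D 1 a × ∃ λ p′ → D n p′ × p ≈ p′ + a * X ^ n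

    Lead⇒D : ∀ {p n a} → Lead p n a → D (suc n) p
    Lead⇒D {n = n} (Da , p′ , Dp′ , e) = D-resp (sym e) (D-+ (D-≤ (ℕ.n≤1+n n) Dp′) (D-*X^ n Da))

    Lead-* : ∀ {p q m n a b} → Lead p m a → Lead q n b → Lead (p * q) (m ℕ.+ n) (a * b)
    Lead-* {p} {q} {m} {n} {a} {b} (Da , p′ , Dp′ , e) Lq@(Db , q′ , Dq′ , f) =
      D-K* Da Db , p′ * q + (a * X ^ m) * q′ ,
      D-+ (D-* Dp′ (Lead⇒D Lq))
          (D-resp (*-comm _ _) (subst (λ k → D k (q′ * (a * X ^ m))) (ℕ.+-comm n m) (D-* Dq′ (D-*X^ m Da)))) ,
      (begin
        p * q
          ≈⟨ *-congʳ e ⟩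
        (p′ + a * X ^ m) * q
          ≈⟨ distribʳ q p′ _ ⟩
        p′ * q + (a * X ^ m) * q
          ≈⟨ +-congˡ (*-congˡ f) ⟩
        p′ * q + (a * X ^ m) * (q′ + b * X ^ n)
          ≈⟨ expand (p′ * q) a (X ^ m) q′ b (X ^ n) ⟩
        (p′ * q + (a * X ^ m) * q′) + (a * b) * (X ^ m * X ^ n)
          ≈⟨ +-congˡ (*-congˡ (^-homo-* X m n)) ⟨
        (p′ * q + (a * X ^ m) * q′) + (a * b) * X ^ (m ℕ.+ n) ∎)
      where
      expand = solve 6 (λ r a u q b v →
          r :+ (a :* u) :* (q :+ b :* v)
            := (r :+ (a :* u) :* q) :+ (a :* b) :* (u :* v)) ≈refl

    Lead-vanish : ∀ {p n N a} → Lead p N a → n ≤ N → D n p → a ≈ 0#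
    Lead-vanish (Da , p′ , Dp′ , e) n≤N Dp = indep (D-+ (D-≤ n≤N Dp) (D-neg Dp′)) Da (sym (move e))

    Lead-drop : ∀ {p N a} → Lead p N a → a ≈ 0# → D N p
    Lead-drop (Da , p′ , Dp′ , e) a≈0 =
      D-resp (sym (trans e (trans (+-congˡ (trans (*-congʳ a≈0) (zeroˡ _))) (+-identityʳ p′)))) Dp′

    split-lead : ∀ {n p} → D (suc n) p → ∃ (Lead p n)
    split-lead Dp with split Dp
    ... | p′ , a , Dp′ , Da , e = a , Da , p′ , Dp′ , e

    -- Vanishing top coefficients are dropped one by one; each test is an instance of excluded
    -- middle under the double negation.
    lead : ∀ N {p} → D N p → p ≉ 0# → ¬ ¬ (∃₂ λ n a → Lead p n a × a ≉ 0#)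
    lead zero Dp p≉0 _ = p≉0 (D-0 Dp)
    lead (suc N) Dp p≉0 with split-lead Dp
    ... | a , L = ¬¬-excluded-middle >>= λ where
      (yes a≈0) → lead N (Lead-drop L a≈0) p≉0
      (no a≉0)  → return (N , a , L , a≉0)

    -- Only the bounds `n` and `N` are compared. A factor `b` is spent in every round, even when the
    -- top coefficient of the dividend happens to be zero, so the result needs no double negation.
    pseudo-division : ∀ {n y b} → Lead y n b → ∀ N x → D N x →
      ∃ λ e → ∃₂ λ A r → D n r × b ^ e * x ≈ A * y + r
    pseudo-division {n} {y} {b} L zero x Dx =
      0 , 0# , x , D-≤ z≤n Dx , trans (*-identityˡ x) (sym (trans (+-congʳ (zeroˡ y)) (+-identityˡ x)))
    pseudo-division {n} {y} {b} L@(Db , y′ , Dy′ , y≈) (suc N) x Dx with n ℕ.≤? N | split Dx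
    ... | no n≰N | _ =
      0 , 0# , x , D-≤ (ℕ.≰⇒> n≰N) Dx , trans (*-identityˡ x) (sym (trans (+-congʳ (zeroˡ y)) (+-identityˡ x)))
    ... | yes n≤N | x′ , a , Dx′ , Da , x≈ = conclude (pseudo-division L N x₁ Dx₁)
      where
      k = N ℕ.∸ n
      k+n≡N : k ℕ.+ n ≡ N
      k+n≡N = ℕ.m∸n+n≡m n≤N
      -- This is `b * x` minus `(a * X ^ k) * y`, written with the two terms in `X ^ N` already
      -- cancelled so that its degree bound `N` is visible.
      x₁ = b * x′ + (- a) * (X ^ k * y′)
      Dx₁ : D N x₁
      Dx₁ = D-+ (D-K* Db Dx′) (D-K* (D-neg Da)
        (D-resp (*-comm _ _) (subst (λ m → D m (y′ * X ^ k)) (≡.trans (ℕ.+-comm n k) k+n≡N) (D-*X^ k Dy′))))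
      expand = solve 7 (λ b x′ a a′ u y′ v →
          (b :* x′ :+ a′ :* (u :* y′)) :+ (a :* u) :* (y′ :+ b :* v)
            := (a′ :+ a) :* (u :* y′) :+ b :* (x′ :+ a :* (u :* v))) ≈refl
      bx≈ : b * x ≈ x₁ + (a * X ^ k) * y
      bx≈ = sym (begin
        x₁ + (a * X ^ k) * y
          ≈⟨ +-congˡ (*-congˡ y≈) ⟩
        x₁ + (a * X ^ k) * (y′ + b * X ^ n)
          ≈⟨ expand b x′ a (- a) (X ^ k) y′ (X ^ n) ⟩
        (- a + a) * (X ^ k * y′) + b * (x′ + a * (X ^ k * X ^ n))
          ≈⟨ +-congʳ (trans (*-congʳ (-‿inverseˡ a)) (zeroˡ _)) ⟩
        0# + b * (x′ + a * (X ^ k * X ^ n))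
          ≈⟨ +-identityˡ _ ⟩
        b * (x′ + a * (X ^ k * X ^ n))
          ≈⟨ *-congˡ (+-congˡ (*-congˡ (trans (sym (^-homo-* X k n)) (^-congʳ X k+n≡N)))) ⟩
        b * (x′ + a * X ^ N)
          ≈⟨ *-congˡ x≈ ⟨
        b * x ∎)
      regroup₁ = solve 3 (λ b d x → (b :* d) :* x := d :* (b :* x)) ≈refl
      regroup₂ = solve 5 (λ d a y A r → (A :* y :+ r) :+ d :* (a :* y) := (A :+ d :* a) :* y :+ r) ≈refl
      conclude : (∃ λ e → ∃₂ λ A r → D n r × b ^ e * x₁ ≈ A * y + r) →
                 ∃ λ e → ∃₂ λ A r → D n r × b ^ e * x ≈ A * y + r
      conclude (e , A , r , Dr , eq) = suc e , A + b ^ e * (a * X ^ k) , r , Dr , (begin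
        (b * b ^ e) * x                               ≈⟨ regroup₁ b (b ^ e) x ⟩
        b ^ e * (b * x)                               ≈⟨ *-congˡ bx≈ ⟩
        b ^ e * (x₁ + (a * X ^ k) * y)                ≈⟨ distribˡ (b ^ e) x₁ _ ⟩
        b ^ e * x₁ + b ^ e * ((a * X ^ k) * y)        ≈⟨ +-congʳ eq ⟩
        (A * y + r) + b ^ e * ((a * X ^ k) * y)       ≈⟨ regroup₂ (b ^ e) (a * X ^ k) y A r ⟩
        (A + b ^ e * (a * X ^ k)) * y + r             ∎)

    RegularOnCoefficients : Carrier → Set (c ⊔ ℓ)
    RegularOnCoefficients b = ∀ z → D 1 z → b * z ≈ 0# → z ≈ 0#

    -- Multiplication by `y` raises the degree by `n`, so the bound on `y * z` kills the
    -- coefficients of `z` from the top down. It yields both regularity and, in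
    -- `meets-both⇒coprime`, the uniqueness of a remainder.
    degree-cancel : ∀ {n y b} → Lead y n b → RegularOnCoefficients b →
      ∀ N {z} → D N z → D n (y * z) → z ≈ 0#
    degree-cancel L reg zero Dz _ = D-0 Dz
    degree-cancel {n} L reg (suc N) Dz Dyz with split-lead Dz
    ... | a , La = degree-cancel L reg N
      (Lead-drop La (reg a (proj₁ La) (Lead-vanish (Lead-* L La) (ℕ.m≤m+n n N) Dyz))) Dyz

    quotient-degree : ∀ {n h} → D 1 h → RegularOnCoefficients h → ∀ M {f} → D M f → D n (h * f) → D n f
    quotient-degree Dh reg zero Df _ = D-≤ z≤n Df
    quotient-degree {n} {h} Dh reg (suc M) {f} Df Dhf with n ℕ.≤? M | split-lead Df
    ... | no n≰M | _ = D-≤ (ℕ.≰⇒> n≰M) Df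
    ... | yes n≤M | a , La = quotient-degree Dh reg M
      (Lead-drop La (reg a (proj₁ La) (Lead-vanish (Lead-* Lh La) n≤M Dhf))) Dhf
      where
      Lh : Lead h 0 h
      Lh = Dh , 0# , D-0# , sym (trans (+-identityˡ _) (*-identityʳ h))

    module _ (*-≉0 : ∀ {x y} → x ≉ 0# → y ≉ 0# → x * y ≉ 0#) where

      ^-≉0 : ∀ {x} → x ≉ 0# → ∀ n → x ^ n ≉ 0#
      ^-≉0 x≉0 zero 1≈0 = x≉0 (trans (sym (*-identityʳ _)) (trans (*-congˡ 1≈0) (zeroʳ _)))
      ^-≉0 x≉0 (suc n) = *-≉0 x≉0 (^-≉0 x≉0 n)

      D-K^ : ∀ {a} → D 1 a → ∀ n → D 1 (a ^ n)
      D-K^ Da zero = D-1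
      D-K^ Da (suc n) = D-K* Da (D-K^ Da n)

      degree-sum< : ∀ {p q m n a b N} → Lead p m a → Lead q n b → a ≉ 0# → b ≉ 0# →
                    D N (p * q) → m ℕ.+ n < N
      degree-sum< {m = m} {n} {N = N} Lp Lq a≉0 b≉0 Dpq with N ℕ.≤? m ℕ.+ n
      ... | yes N≤ = ⊥-elim (*-≉0 a≉0 b≉0 (Lead-vanish (Lead-* Lp Lq) N≤ Dpq))
      ... | no N≰  = ℕ.≰⇒> N≰

      -- A gcd over the fraction field of the coefficient ring, with denominators cleared: `g`
      -- divides `x` and `y` only after multiplication by `a` and `b`. Over F these are units; over
      -- F[α] Gauss's lemma removes them.
      record PseudoGCD (x y : Carrier) : Set (c ⊔ ℓ) where
        field
          {g s t a b A B} : Carrier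
          {N}     : ℕ
          D-g     : D N g
          g≉0     : g ≉ 0#
          bézout  : s * x + t * y ≈ g
          D-a     : D 1 a
          a≉0     : a ≉ 0#
          ax≈Ag   : a * x ≈ A * g
          D-b     : D 1 b
          b≉0     : b ≉ 0#
          by≈Bg   : b * y ≈ B * g

      euclid : ∀ n {M x y} → D M x → D n y → x ≉ 0# → ¬ ¬ PseudoGCD x y
      euclid zero {M} {x} {y} Dx Dy x≉0 = return record
        { D-g = Dx ; g≉0 = x≉0
        ; bézout = trans (+-cong (*-identityˡ x) (zeroˡ y)) (+-identityʳ x)
        ; D-a = D-1 ; a≉0 = ^-≉0 x≉0 0 ; ax≈Ag = ≈refl
        ; D-b = D-1 ; b≉0 = ^-≉0 x≉0 0
        ; by≈Bg = trans (*-identityˡ y) (trans (D-0 Dy) (sym (zeroˡ x))) }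
      euclid (suc n) {M} {x} {y} Dx Dy x≉0 with split-lead Dy
      ... | b , Ly = ¬¬-excluded-middle >>= λ where
          (yes b≈0) → euclid n Dx (Lead-drop Ly b≈0) x≉0
          (no b≉0) → step b≉0 (pseudo-division Ly M x Dx)
        where
        module _ (b≉0 : b ≉ 0#) where
          y≉0 : y ≉ 0#
          y≉0 y≈0 = b≉0 (Lead-vanish Ly z≤n (D-resp (sym y≈0) D-0#))
          regroup₁ = solve 6 (λ s t d x A y →
              (t :* d) :* x :+ (s :+ t :* A) :* y
                := s :* y :+ t :* (d :* x :+ A :* y)) ≈refl
          regroup₂ = solve 4 (λ a b d x → ((a :* b) :* d) :* x := (a :* b) :* (d :* x)) ≈refl
          regroup₃ = solve 5 (λ a b A y r → (a :* b) :* (A :* y :+ r) := (b :* A) :* (a :* y) :+ a :* (b :* r)) ≈refl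
          regroup₄ = solve 5 (λ u a A B g → u :* (A :* g) :+ a :* (B :* g) := (u :* A :+ a :* B) :* g) ≈refl
          step : (∃ λ e → ∃₂ λ A r → D n r × b ^ e * x ≈ A * y + r) → ¬ ¬ PseudoGCD x y
          step (e , A , r , Dr , eq) = euclid n Dy Dr y≉0 >>= λ G → let module G = PseudoGCD G in
            return record
              { D-g = G.D-g ; g≉0 = G.g≉0
              ; s = G.t * b ^ e ; t = G.s + G.t * - A
              ; bézout = begin
                  (G.t * b ^ e) * x + (G.s + G.t * - A) * y   ≈⟨ regroup₁ G.s G.t (b ^ e) x (- A) y ⟩
                  G.s * y + G.t * (b ^ e * x + - A * y)       ≈⟨ +-congˡ (*-congˡ (+-congˡ (-‿distribˡ-* A y))) ⟨
                  G.s * y + G.t * (b ^ e * x + - (A * y))     ≈⟨ +-congˡ (*-congˡ (move eq)) ⟨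
                  G.s * y + G.t * r                           ≈⟨ G.bézout ⟩
                  G.g                                         ∎
              ; D-a = D-K* (D-K* G.D-a G.D-b) (D-K^ (proj₁ Ly) e)
              ; a≉0 = *-≉0 (*-≉0 G.a≉0 G.b≉0) (^-≉0 b≉0 e)
              ; ax≈Ag = begin
                  ((G.a * G.b) * b ^ e) * x                   ≈⟨ regroup₂ G.a G.b (b ^ e) x ⟩
                  (G.a * G.b) * (b ^ e * x)                   ≈⟨ *-congˡ eq ⟩
                  (G.a * G.b) * (A * y + r)                   ≈⟨ regroup₃ G.a G.b A y r ⟩
                  (G.b * A) * (G.a * y) + G.a * (G.b * r)     ≈⟨ +-cong (*-congˡ G.ax≈Ag) (*-congˡ G.by≈Bg) ⟩
                  (G.b * A) * (G.A * G.g) + G.a * (G.B * G.g) ≈⟨ regroup₄ (G.b * A) G.a G.A G.B G.g ⟩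
                  ((G.b * A) * G.A + G.a * G.B) * G.g         ∎
              ; D-b = G.D-a ; b≉0 = G.a≉0 ; by≈Bg = G.ax≈Ag }

  -- A ring that behaves like F[α][β] for a field F: Dβ is the β-degree and
  -- Dα the α-degree on Dβ 1 = F[α], with Dα 1 = F.
  module TwoVariables
    {Dα Dβ : ℕ → Carrier → Set ℓ} {α β : Carrier}
    (filtrationα : Filtration Dα α) (filtrationβ : Filtration Dβ β)
    (Dα⇒Dβ : ∀ {n p} → Dα n p → Dβ 1 p)
    (Dβ⇒Dα : ∀ {p} → Dβ 1 p → ∃ λ n → Dα n p)
    (exhaust : ∀ p → ∃ λ n → Dβ n p)
    (unit : ∀ {p} → Dα 1 p → p ≉ 0# → Unit p)
    where

    -- Regular elements, primes of F[α] and Gauss's lemma.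

    private
      module A = Filtration filtrationα
      module B = Filtration filtrationβ

    regular-coefficient : ∀ {p} → Dβ 1 p → p ≉ 0# → ¬ ¬ B.RegularOnCoefficients p
    regular-coefficient Dp p≉0 = A.lead _ (proj₂ (Dβ⇒Dα Dp)) p≉0 >>= λ (n , a , L , a≉0) →
      return λ z Dz pz≈0 → A.degree-cancel L (λ w _ → unit-regular (unit (proj₁ L) a≉0) w)
        _ (proj₂ (Dβ⇒Dα Dz)) (A.D-resp (sym pz≈0) (A.D-≤ z≤n A.D-0#))

    -- One variable at a time: the leading coefficient in β is a nonzero polynomial in α, whose own
    -- leading coefficient is a unit.
    regular : ∀ {p} → p ≉ 0# → ¬ ¬ Regular p
    regular {p} p≉0 = B.lead _ (proj₂ (exhaust p)) p≉0 >>= λ (n , a , L , a≉0) →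
      regular-coefficient (proj₁ L) a≉0 >>= λ reg →
      return λ z pz≈0 → B.degree-cancel L reg _ (proj₂ (exhaust z))
        (B.D-resp (sym pz≈0) (B.D-≤ z≤n B.D-0#))

    *-≉0 : ∀ {x y} → x ≉ 0# → y ≉ 0# → x * y ≉ 0#
    *-≉0 x≉0 y≉0 xy≈0 = regular x≉0 λ reg → y≉0 (reg _ xy≈0)

    Constant : Carrier → Set ℓ
    Constant = Dα 1

    Reducible : Carrier → Set (c ⊔ ℓ)
    Reducible p = ∃₂ λ h f → Dβ 1 h × Dβ 1 f × ¬ Constant h × ¬ Constant f × h * f ≈ p

    -- In the principal ideal domain F[α] a nonzero prime generates a maximal ideal; the Bézout
    -- identity is the form in which `gauss-prime` uses this.
    Prime : Carrier → Set (c ⊔ ℓ)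
    Prime π = ∀ {a} → Dβ 1 a → ¬ ¬ (π ∣ a ⊎ ∃₂ λ s t → s * π + t * a ≈ 1#)

    -- The gcd of `π` and `a` in F[α] is either a unit, which gives the Bézout identity, or an
    -- associate of `π`.
    irreducible⇒prime : ∀ {π} → Dβ 1 π → π ≉ 0# → ¬ Reducible π → Prime π
    irreducible⇒prime {π} Dπ π≉0 irr {a} Da =
      A.euclid *-≉0 _ (proj₂ (Dβ⇒Dα Dπ)) (proj₂ (Dβ⇒Dα Da)) π≉0 >>= λ G →
      let module G = A.PseudoGCD G
          Dg = Dα⇒Dβ G.D-g
          g∣π = divides (unit G.D-a G.a≉0) G.ax≈Ag
          g∣a = divides (unit G.D-b G.b≉0) G.by≈Bg
          f , gf≈π = g∣π
          f≉0 = factor≉0ʳ gf≈π π≉0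
      in ¬¬-excluded-middle >>= λ where
        (yes g-const) → let g⁻¹ , gg⁻¹≈1 = unit g-const G.g≉0 in
          return (inj₂ (G.s * g⁻¹ , G.t * g⁻¹ ,
            trans (regroup G.s G.t g⁻¹ π a) (trans (*-congʳ G.bézout) gg⁻¹≈1)))
        (no g-nonconst) → regular-coefficient Dg G.g≉0 >>= λ reg → ¬¬-excluded-middle >>= λ where
          (yes f-const) → return (inj₁ (∣-trans
            (unit-∣ (unit f-const f≉0) (trans (*-comm f G.g) gf≈π)) g∣a))
          (no f-nonconst) → λ _ → irr (G.g , f , Dg ,
            -- The cofactor was found in F[α,β]; comparing degrees in β puts it back into F[α].
            B.quotient-degree Dg reg _ (proj₂ (exhaust f)) (B.D-resp (sym gf≈π) Dπ) ,
            g-nonconst , f-nonconst , gf≈π)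
      where
      regroup = solve 5 (λ s t w x y → (s :* w) :* x :+ (t :* w) :* y := (s :* x :+ t :* y) :* w) ≈refl
      divides : ∀ {u x A g} → Unit u → u * x ≈ A * g → g ∣ x
      divides {A = A} {g} u ux≈Ag = ∣-trans (A , trans (*-comm g A) (sym ux≈Ag)) (unit-∣ u ≈refl)

    -- As `π` is free of β, the quotient obeys the same degree bound as `P * Q`, and top
    -- coefficients can be compared.
    lead-divides : ∀ {π P Q M N a b} → Dβ 1 π → B.RegularOnCoefficients π →
      B.Lead P M a → B.Lead Q N b → π ∣ P * Q → π ∣ a * b
    lead-divides {π} {P} {Q} {M} {N} {a} {b} Dπ reg LP LQ (E , πE≈PQ) =
      compare (B.Lead-* LP LQ) (B.split-lead DE)
      where
      expand = solve 4 (λ p x e z → p :* (x :+ e :* z) := p :* x :+ (p :* e) :* z) ≈refl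
      DE : Dβ (suc (M ℕ.+ N)) E
      DE = B.quotient-degree Dπ reg _ (proj₂ (exhaust E))
        (B.D-resp (sym πE≈PQ) (B.D-* (B.Lead⇒D LP) (B.Lead⇒D LQ)))
      compare : B.Lead (P * Q) (M ℕ.+ N) (a * b) → ∃ (B.Lead E (M ℕ.+ N)) → π ∣ a * b
      compare (Dab , R , DR , PQ≈) (e , De , E′ , DE′ , E≈) = e , sym (unmove (B.indep
        (B.D-+ (B.D-K* Dπ DE′) (B.D-neg DR))
        (B.D-+ Dab (B.D-neg (B.D-K* Dπ De)))
        (begin
          π * E′ + - R
            ≈⟨ transpose (trans (sym (trans (*-congˡ E≈) (expand π E′ e _))) (trans πE≈PQ PQ≈)) ⟩
          (a * b) * β ^ (M ℕ.+ N) + - ((π * e) * β ^ (M ℕ.+ N))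
            ≈⟨ +-congˡ (-‿distribˡ-* (π * e) _) ⟩
          (a * b) * β ^ (M ℕ.+ N) + - (π * e) * β ^ (M ℕ.+ N)
            ≈⟨ distribʳ _ (a * b) (- (π * e)) ⟨
          (a * b + - (π * e)) * β ^ (M ℕ.+ N) ∎)))

    bézout-∣ : ∀ {π a b} s t → s * π + t * a ≈ 1# → π ∣ a * b → π ∣ b
    bézout-∣ {π} {a} {b} s t eq (e , πe≈ab) = s * b + t * e , sym (begin
      b                            ≈⟨ *-identityˡ b ⟨
      1# * b                       ≈⟨ *-congʳ eq ⟨
      (s * π + t * a) * b          ≈⟨ regroup₁ s π t a b ⟩
      π * (s * b) + t * (a * b)    ≈⟨ +-congˡ (*-congˡ πe≈ab) ⟨
      π * (s * b) + t * (π * e)    ≈⟨ regroup₂ π (s * b) t e ⟩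
      π * (s * b + t * e)          ∎)
      where
      regroup₁ = solve 5 (λ s p t a b → (s :* p :+ t :* a) :* b := p :* (s :* b) :+ t :* (a :* b)) ≈refl
      regroup₂ = solve 4 (λ p u t e → p :* u :+ t :* (p :* e) := p :* (u :+ t :* e)) ≈refl

    -- Induction on the degrees of P and Q: the prime divides the product of the
    -- two top coefficients, hence one of them, whose term can be dropped.
    gauss-prime : ∀ {π} → Dβ 1 π → B.RegularOnCoefficients π → Prime π →
      ∀ M N {P Q} → Dβ M P → Dβ N Q → π ∣ P * Q → ¬ ¬ (π ∣ P ⊎ π ∣ Q)
    gauss-prime Dπ reg prime zero N DP DQ _ = return (inj₁ (∣-0 (B.D-0 DP)))
    gauss-prime Dπ reg prime (suc M) zero DP DQ _ = return (inj₂ (∣-0 (B.D-0 DQ)))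
    gauss-prime {π} Dπ reg prime (suc M) (suc N) {P} {Q} DP DQ (E , πE≈PQ)
      with B.split-lead DP | B.split-lead DQ
    ... | a , LP@(Da , P′ , DP′ , P≈) | b , LQ@(Db , Q′ , DQ′ , Q≈) =
      prime Da >>= λ where
        (inj₁ π∣a) → gauss-prime Dπ reg prime M (suc N) DP′ DQ
            (∣-resp (sym (move (trans (*-congʳ P≈) (distrib′ P′ (a * β ^ M) Q))))
              (∣-+ (E , πE≈PQ) (∣-neg (∣-* Q (∣-* (β ^ M) π∣a))))) >>= λ where
          (inj₁ π∣P′) → return (inj₁ (∣-resp (sym P≈) (∣-+ π∣P′ (∣-* (β ^ M) π∣a))))
          (inj₂ π∣Q)  → return (inj₂ π∣Q)
        (inj₂ (s , t , sπ+ta≈1)) → let π∣b = bézout-∣ s t sπ+ta≈1 (lead-divides Dπ reg LP LQ (E , πE≈PQ)) in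
          gauss-prime Dπ reg prime (suc M) N DP DQ′
            (∣-resp (sym (move (trans (*-congˡ Q≈) (distrib″ P Q′ (b * β ^ N)))))
              (∣-+ (E , πE≈PQ) (∣-neg (∣-* P (∣-* (β ^ N) π∣b))))) >>= λ where
          (inj₁ π∣P)  → return (inj₁ π∣P)
          (inj₂ π∣Q′) → return (inj₂ (∣-resp (sym Q≈) (∣-+ π∣Q′ (∣-* (β ^ N) π∣b))))
      where
      distrib′ = solve 3 (λ p r q → (p :+ r) :* q := r :* q :+ p :* q) ≈refl
      distrib″ = solve 3 (λ p q r → p :* (q :+ r) := r :* p :+ p :* q) ≈refl

    -- Gauss's lemma, by induction on the degree of c: a reducible c is treated
    -- factor by factor, an irreducible one is prime.
    gauss : ∀ n {c z A g} → Dα n c → c ≉ 0# → c * z ≈ A * g →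
      ¬ ¬ (∃₂ λ u g′ → Dβ 1 u × g ≈ u * g′ × g′ ∣ z)
    gauss zero Dc c≉0 _ _ = c≉0 (A.D-0 Dc)
    gauss (suc n) {c} {z} {A} {g} Dc c≉0 cz≈Ag = ¬¬-excluded-middle {A = Reducible c} >>= λ where
        (yes (h , f , Dh , Df , h-nonconst , f-nonconst , hf≈c)) →
          let h≉0 = factor≉0ˡ hf≈c c≉0
              f≉0 = factor≉0ʳ hf≈c c≉0
          in A.lead _ (proj₂ (Dβ⇒Dα Dh)) h≉0 >>= λ (d , a , Lh , a≉0) →
             A.lead _ (proj₂ (Dβ⇒Dα Df)) f≉0 >>= λ (e , b , Lf , b≉0) →
             let d+e≤n = ℕ.s≤s⁻¹ (A.degree-sum< *-≉0 Lh Lf a≉0 b≉0 (A.D-resp (sym hf≈c) Dc))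
                 0<d = positive Lh h-nonconst
                 0<e = positive Lf f-nonconst
                 -- Since `f` is nonconstant, `suc d ≤ d + e`, which lowers the bound for `h` from
                 -- `suc n` to `n`; symmetrically for `f`.
                 Dnh = A.D-≤ (ℕ.≤-trans (subst (_≤ d ℕ.+ e) (ℕ.+-comm d 1) (ℕ.+-monoʳ-≤ d 0<e)) d+e≤n) (A.Lead⇒D Lh)
                 Dnf = A.D-≤ (ℕ.≤-trans (ℕ.+-monoˡ-≤ e 0<d) d+e≤n) (A.Lead⇒D Lf)
             in gauss n Dnh h≉0 (trans (sym (*-assoc h f z)) (trans (*-congʳ hf≈c) cz≈Ag)) >>= λ where
               (u , g′ , Du , g≈ , B , g′B≈fz) →
                 gauss n Dnf f≉0 (trans (sym g′B≈fz) (*-comm g′ B)) >>= λ where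
                   (v , g″ , Dv , g′≈ , g″∣z) → return (u * v , g″ , B.D-K* Du Dv ,
                     trans g≈ (trans (*-congˡ g′≈) (sym (*-assoc u v g″))) , g″∣z)
        (no irr) →
          let Dβc = Dα⇒Dβ Dc in
          regular c≉0 >>= λ reg →
          gauss-prime Dβc (λ w _ → reg w) (irreducible⇒prime Dβc c≉0 irr) _ _
            (proj₂ (exhaust A)) (proj₂ (exhaust g)) (z , cz≈Ag) >>= λ where
          (inj₁ (A′ , cA′≈A)) → return (1# , g , B.D-1 , sym (*-identityˡ g) ,
            (A′ , trans (*-comm g A′) (sym (cancel reg (trans cz≈Ag (trans (*-congʳ (sym cA′≈A)) (*-assoc c A′ g)))))))
          (inj₂ (g′ , cg′≈g)) → return (c , g′ , Dβc , sym cg′≈g ,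
            (A , sym (cancel reg (trans cz≈Ag (trans (*-congˡ (sym cg′≈g)) (regroup A c g′))))))
      where
      regroup = solve 3 (λ a c g → a :* (c :* g) := c :* (g :* a)) ≈refl
      positive : ∀ {p m a} → A.Lead p m a → ¬ Constant p → 0 < m
      positive {m = zero} L nonconst = ⊥-elim (nonconst (A.Lead⇒D L))
      positive {m = suc m} L nonconst = s≤s z≤n

    -- Elimination of β, common factors and leading monomials.

    MeetsCoefficients : Carrier → Carrier → Set (c ⊔ ℓ)
    MeetsCoefficients x y = ∃ λ l → ∃₂ λ s t → Dβ 1 l × l ≉ 0# × s * x + t * y ≈ l

    CommonFactor : Carrier → Carrier → Set (c ⊔ ℓ)
    CommonFactor x y = ∃ λ g → ¬ Constant g × g ∣ x × g ∣ y

    -- The pseudo-gcd `g` either lies in F[α] already or involves β. In the latter case Gauss's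
    -- lemma strips factors in F[α] from it, once for `x` and once for `y`, and what remains still
    -- involves β.
    meets-or-common-factor : ∀ {x y} → x ≉ 0# → y ≉ 0# → ¬ ¬ (MeetsCoefficients x y ⊎ CommonFactor x y)
    meets-or-common-factor {x} {y} x≉0 y≉0 =
      B.euclid *-≉0 _ (proj₂ (exhaust x)) (proj₂ (exhaust y)) x≉0 >>= λ G →
      let module G = B.PseudoGCD G in
      ¬¬-excluded-middle >>= λ where
        (yes Dg) → return (inj₁ (G.g , G.s , G.t , Dg , G.g≉0 , G.bézout))
        (no ¬Dg) →
          gauss _ (proj₂ (Dβ⇒Dα G.D-a)) G.a≉0 G.ax≈Ag >>= λ (u , g′ , Du , g≈ , g′∣x) →
          gauss _ (proj₂ (Dβ⇒Dα G.D-b)) G.b≉0 (trans G.by≈Bg (trans (*-congˡ g≈) (sym (*-assoc G.B u g′))))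
            >>= λ (v , g″ , Dv , g′≈ , g″∣y) →
          return (inj₂ (g″ ,
            (λ g″-const → ¬Dg (B.D-resp (sym (trans g≈ (*-congˡ g′≈))) (B.D-K* Du (B.D-K* Dv (Dα⇒Dβ g″-const))))) ,
            ∣-trans (v , trans (*-comm g″ v) (sym g′≈)) g′∣x , g″∣y))

    -- Here m plays the role of an element of F[β], but only its unit leading
    -- coefficient matters.  If x f = y e, then l e = x w and m e = x w′, so
    -- l w′ = m w; dividing w′ by m shows that l divides w up to a unit.
    meets-both⇒coprime : ∀ {x y m n b} → Regular x → MeetsCoefficients x y →
      (∃₂ λ s t → s * x + t * y ≈ m) → B.Lead m n b → Unit b → ¬ ¬ Coprime x y
    meets-both⇒coprime {x} {y} {m} {n} {b} regx (l , s , t , Dl , l≉0 , l≈) (s′ , t′ , m≈) Lm ub =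
      regular l≉0 >>= λ regl → return λ e f xf≈ye →
        let w  = s * e + t * f
            w′ = s′ * e + t′ * f
            le≈xw  = multiple s t l≈ xf≈ye
            me≈xw′ = multiple s′ t′ m≈ xf≈ye
            lw′≈mw = cancel regx (begin
              x * (l * w′)  ≈⟨ exchange x l w′ ⟩
              l * (x * w′)  ≈⟨ *-congˡ me≈xw′ ⟨
              l * (m * e)   ≈⟨ exchange l m e ⟩
              m * (l * e)   ≈⟨ *-congˡ le≈xw ⟩
              m * (x * w)   ≈⟨ exchange m x w ⟩
              x * (m * w)   ∎)
            k , A , r , Dr , eq = B.pseudo-division Lm _ w′ (proj₂ (exhaust w′))
            q = b ^ k * w + - (A * l)
            lr≈mq = begin
              l * r                                   ≈⟨ *-congˡ (move eq) ⟩
              l * (b ^ k * w′ + - (A * m))            ≈⟨ *-congˡ (+-congˡ (-‿distribˡ-* A m)) ⟩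
              l * (b ^ k * w′ + - A * m)              ≈⟨ regroup₁ l (b ^ k) w′ (- A) m ⟩
              b ^ k * (l * w′) + m * (- A * l)        ≈⟨ +-congʳ (*-congˡ lw′≈mw) ⟩
              b ^ k * (m * w) + m * (- A * l)         ≈⟨ regroup₂ (b ^ k) m w (- A * l) ⟩
              m * (b ^ k * w + - A * l)               ≈⟨ *-congˡ (+-congˡ (-‿distribˡ-* A l)) ⟨
              m * q                                   ∎
            -- As `l` is free of β, `l * r` has degree below `n`; a multiple of `m` with so small a
            -- degree vanishes.
            q≈0 = B.degree-cancel Lm (λ z _ → unit-regular ub z) _ (proj₂ (exhaust q))
                    (B.D-resp lr≈mq (B.D-K* Dl Dr))
            bᵏe≈xA = cancel regl (begin
              l * (b ^ k * e)      ≈⟨ exchange l (b ^ k) e ⟩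
              b ^ k * (l * e)      ≈⟨ *-congˡ le≈xw ⟩
              b ^ k * (x * w)      ≈⟨ exchange (b ^ k) x w ⟩
              x * (b ^ k * w)      ≈⟨ *-congˡ (unmove q≈0) ⟩
              x * (A * l)          ≈⟨ regroup₃ x A l ⟩
              l * (x * A)          ∎)
        in ∣-trans (A , sym bᵏe≈xA) (unit-∣ (unit-^ ub k) ≈refl)
      where
      exchange = solve 3 (λ x y z → x :* (y :* z) := y :* (x :* z)) ≈refl
      regroup₀ = solve 5 (λ s x t y e → (s :* x :+ t :* y) :* e := s :* (x :* e) :+ t :* (y :* e)) ≈refl
      regroup₀′ = solve 5 (λ s x t f e → s :* (x :* e) :+ t :* (x :* f) := x :* (s :* e :+ t :* f)) ≈refl
      regroup₁ = solve 5 (λ l u w a m → l :* (u :* w :+ a :* m) := u :* (l :* w) :+ m :* (a :* l)) ≈refl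
      regroup₂ = solve 4 (λ u m w a → u :* (m :* w) :+ m :* a := m :* (u :* w :+ a)) ≈refl
      regroup₃ = solve 3 (λ x a l → x :* (a :* l) := l :* (x :* a)) ≈refl
      multiple : ∀ s t {l e f} → s * x + t * y ≈ l → x * f ≈ y * e → l * e ≈ x * (s * e + t * f)
      multiple s t {l} {e} {f} l≈ xf≈ye = begin
        l * e                        ≈⟨ *-congʳ l≈ ⟨
        (s * x + t * y) * e          ≈⟨ regroup₀ s x t y e ⟩
        s * (x * e) + t * (y * e)    ≈⟨ +-congˡ (*-congˡ xf≈ye) ⟨
        s * (x * e) + t * (x * f)    ≈⟨ regroup₀′ s x t f e ⟩
        x * (s * e + t * f)          ∎

    -- Lexicographic leading monomial αᵏβⁿ.
    LM : Carrier → ℕ → ℕ → Set (c ⊔ ℓ)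
    LM p k n = ∃₂ λ a u → B.Lead p n a × A.Lead a k u × u ≉ 0#

    LM-exists : ∀ {p} → p ≉ 0# → ¬ ¬ (∃₂ λ k n → LM p k n)
    LM-exists {p} p≉0 = B.lead _ (proj₂ (exhaust p)) p≉0 >>= λ (n , a , La , a≉0) →
      A.lead _ (proj₂ (Dβ⇒Dα (proj₁ La))) a≉0 >>= λ (k , u , Lu , u≉0) →
      return (k , n , a , u , La , Lu , u≉0)

    LM-* : ∀ {p q k n k′ n′} → LM p k n → LM q k′ n′ → LM (p * q) (k ℕ.+ k′) (n ℕ.+ n′)
    LM-* (a , u , La , Lu , u≉0) (b , v , Lb , Lv , v≉0) =
      a * b , u * v , B.Lead-* La Lb , A.Lead-* Lu Lv , *-≉0 u≉0 v≉0

    LM-resp : ∀ {p q k n} → p ≈ q → LM p k n → LM q k n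
    LM-resp p≈q (a , u , (Da , p′ , Dp′ , p≈) , rest) = a , u , (Da , p′ , Dp′ , trans (sym p≈q) p≈) , rest

    nonconstant⇒LM-positive : ∀ {p k n} → LM p k n → ¬ Constant p → 0 < k ℕ.+ n
    nonconstant⇒LM-positive {k = zero} {zero} (a , u , (Da , p′ , Dp′ , p≈) , Lu , _) nonconst =
      ⊥-elim (nonconst (A.D-resp (sym (trans p≈ (trans (+-cong (B.D-0 Dp′) (*-identityʳ a)) (+-identityˡ a)))) (A.Lead⇒D Lu)))
    nonconstant⇒LM-positive {k = zero} {suc n} _ _ = s≤s z≤n
    nonconstant⇒LM-positive {k = suc k} _ _ = s≤s z≤n

-- Supports, the degree filtrations in α and β, and the exchange of the variables.

module Support {c ℓ} (R : CommutativeRing c ℓ) where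
  open CommutativeRing R using (Carrier; _≈_; 0#; 1#)
  private module R = CommutativeRing R
  open Poly2 R
  open Polynomials R
  open CommutativeRing polyRing
    using (_+_; _*_; -_; sym; trans; reflexive; *-cong; *-congˡ; *-congʳ; +-cong; +-congˡ; +-congʳ)
    renaming (refl to ≋refl)
  open import Algebra.Properties.Semiring.Exp (CommutativeRing.semiring polyRing) using (_^_)

  supp-resp : ∀ {P p q} → p ≋ q → Supp P p → Supp P q
  supp-resp e s .off i j ¬P = R.trans (R.sym (e .at i j)) (s .off i j ¬P)

  supp-⊆ : ∀ {P Q p} → (∀ {i j} → P i j → Q i j) → Supp P p → Supp Q p
  supp-⊆ f s .off i j ¬Q = s .off i j (¬Q ∘ f)

  supp-+ : ∀ {P p q} → Supp P p → Supp P q → Supp P (p + q)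
  supp-+ {p = p} {q} s t .off i j ¬P =
    R.trans (coeff-⊕ p q i j) (R.trans (R.+-cong (s .off i j ¬P) (t .off i j ¬P)) (R.+-identityˡ 0#))

  supp-neg : ∀ {P p} → Supp P p → Supp P (- p)
  supp-neg {p = p} s .off i j ¬P = R.trans (coeff-⊖ p i j) (R.trans (R.-‿cong (s .off i j ¬P)) -0#≈0#)
    where open import Algebra.Properties.Ring R.ring using (-0#≈0#)

  supp-0 : ∀ {P} → Supp P 0P
  supp-0 .off i j _ = R.refl

  supp-mono : ∀ {P a i j} → P i j → Supp P (mono a i j)
  supp-mono Pij = All⇒Supp _ (Pij ∷ [])

  supp-* : ∀ {P Q W p q} → (∀ i j → Dec (P i j)) → (∀ i j → Dec (Q i j)) →
    (∀ {i j k l} → P i j → Q k l → W (i ℕ.+ k) (j ℕ.+ l)) → Supp P p → Supp Q q → Supp W (p * q)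
  supp-* {p = p} {q} P? Q? f sp sq =
    supp-resp (trans (reflexive (≡.sym (·≡ (restrict P? p) (restrict Q? q))))
                (sym (*-cong (coeffwise (restrict-≃ P? p sp)) (coeffwise (restrict-≃ Q? q sq)))))
      (All⇒Supp _ (*-All f _ _ (restrict-All P? p) (restrict-All Q? q)))

  partition : ∀ {P Q : Region} {p} (P? : ∀ i j → Dec (P i j)) (Q? : ∀ i j → Dec (Q i j)) →
    (∀ {i j} → P i j → ¬ Q i j) → Supp (λ i j → P i j ⊎ Q i j) p → p ≋ restrict P? p + restrict Q? p
  partition {p = p} P? Q? disjoint s .at i j =
    R.trans parts (R.sym (coeff-⊕ (restrict P? p) (restrict Q? p) i j))
    where
    parts : coeff p i j ≈ coeff (restrict P? p) i j R.+ coeff (restrict Q? p) i j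
    parts with P? i j | Q? i j
    ... | yes Pij | _ = R.sym (R.trans (R.+-cong (coeff-restrict P? p i j Pij)
                          (All⇒Supp _ (restrict-All Q? p) .off i j (disjoint Pij))) (R.+-identityʳ _))
    ... | no ¬P | yes Qij = R.sym (R.trans (R.+-cong (All⇒Supp _ (restrict-All P? p) .off i j ¬P)
                          (coeff-restrict Q? p i j Qij)) (R.+-identityˡ _))
    ... | no ¬P | no ¬Q = R.trans (s .off i j λ { (inj₁ Pij) → ¬P Pij ; (inj₂ Qij) → ¬Q Qij })
                          (R.sym (R.trans (R.+-cong (All⇒Supp _ (restrict-All P? p) .off i j ¬P)
                            (All⇒Supp _ (restrict-All Q? p) .off i j ¬Q)) (R.+-identityˡ 0#)))

  mono-cong : ∀ {a b} i j → a ≈ b → mono a i j ≋ mono b i j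
  mono-cong i j a≈b .at k l = coeff-mono-cong i j k l a≈b

  α^ : ∀ n → αP ^ n ≋ mono 1# n 0
  α^ zero = ≋refl
  α^ (suc n) = trans (*-congˡ (α^ n)) (trans (reflexive (·≡ αP _)) (mono-cong (suc n) 0 (R.*-identityˡ 1#)))

  β^ : ∀ n → βP ^ n ≋ mono 1# 0 n
  β^ zero = ≋refl
  β^ (suc n) = trans (*-congˡ (β^ n)) (trans (reflexive (·≡ βP _)) (mono-cong 0 (suc n) (R.*-identityˡ 1#)))

  ∷-· : ∀ a i j p q → ((a , i , j) ∷ p) · q ≋ scale a i j q ⊕ (p · q)
  ∷-· a i j p q = reflexive (≡.trans (·≡ _ q) (≡.trans (∷-* a i j p q)
    (≡.trans (cong (scale a i j q ++_) (≡.sym (·≡ p q))) (≡.sym (⊕≡ _ _)))))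

  divide-mono : ∀ {W} k l p →
    All (λ (_ , i , j) → ∃₂ λ i′ j′ → i ≡ i′ ℕ.+ k × j ≡ j′ ℕ.+ l × W i′ j′) p →
    ∃ λ a → Supp W a × p ≋ a * mono 1# k l
  divide-mono {W} k l p ps = let a , Wa , e = go p ps in a , All⇒Supp a Wa , e
    where
    go : ∀ p → All (λ (_ , i , j) → ∃₂ λ i′ j′ → i ≡ i′ ℕ.+ k × j ≡ j′ ℕ.+ l × W i′ j′) p →
      ∃ λ a → All (OnTerm W) a × p ≋ a * mono 1# k l
    go [] [] = [] , [] , sym (CommutativeRing.zeroˡ polyRing _)
    go ((b , _ , _) ∷ p) ((i′ , j′ , refl , refl , Wij) ∷ ps) with go p ps
    ... | a , Wa , e = (b , i′ , j′) ∷ a , Wij ∷ Wa ,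
      trans (reflexive (≡.sym (⊕≡ (mono b _ _) p)))
        (trans (+-cong (mono-cong (i′ ℕ.+ k) (j′ ℕ.+ l) (R.sym (R.*-identityʳ b))) e) (sym (∷-· b i′ j′ a (mono 1# k l))))

  coeff-*-mono : ∀ a k l i j → coeff (a * mono 1# k l) (i ℕ.+ k) (j ℕ.+ l) ≈ coeff a i j
  coeff-*-mono [] k l i j = CommutativeRing.zeroˡ polyRing (mono 1# k l) .at (i ℕ.+ k) (j ℕ.+ l)
  coeff-*-mono ((b , i′ , j′) ∷ a) k l i j =
    R.trans (∷-· b i′ j′ a (mono 1# k l) .at (i ℕ.+ k) (j ℕ.+ l))
      (R.trans (coeff-⊕ (mono (b R.* 1#) (i′ ℕ.+ k) (j′ ℕ.+ l)) (a * mono 1# k l) _ _)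
        (R.trans (R.+-cong shifted (coeff-*-mono a k l i j)) (R.sym (coeff-∷ b i′ j′ a i j))))
    where
    shifted : coeff (mono (b R.* 1#) (i′ ℕ.+ k) (j′ ℕ.+ l)) (i ℕ.+ k) (j ℕ.+ l) ≈ coeff (mono b i′ j′) i j
    shifted with (i′ ℕ.≟ i) ×-dec (j′ ℕ.≟ j)
    ... | yes (refl , refl) = R.trans (coeff-mono-≡ _ (i ℕ.+ k) (j ℕ.+ l))
                                (R.trans (R.*-identityʳ b) (R.sym (coeff-mono-≡ b i j)))
    ... | no ne = R.trans
      (coeff-mono-≢ _ (i′ ℕ.+ k) (j′ ℕ.+ l) λ (e , e′) → ne (ℕ.+-cancelʳ-≡ k i′ i e , ℕ.+-cancelʳ-≡ l j′ j e′))
      (R.sym (coeff-mono-≢ b i′ j′ ne))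

  Total< : ℕ → Region
  Total< n i j = i ℕ.+ j < n

  bounded : ∀ p → ∃ λ n → Supp (Total< n) p
  bounded p = let n , a = go p in n , All⇒Supp p a
    where
    go : ∀ p → ∃ λ n → All (OnTerm (Total< n)) p
    go [] = 0 , []
    go ((_ , i , j) ∷ p) with go p
    ... | n , ps = suc (i ℕ.+ j) ℕ.+ n , ℕ.m≤m+n _ n ∷ All.map (λ lt → ℕ.≤-trans lt (ℕ.m≤n+m n _)) ps

  degβ< : ℕ → Region
  degβ< n i j = j < n

  -- The clause `j < 1` confines this filtration to F[α], so that its first stage is the field of
  -- constants.
  degα< : ℕ → Region
  degα< n i j = i < n × j < 1

  private
    degβ? : ∀ n i j → Dec (degβ< n i j)
    degβ? n i j = j ℕ.<? n
    degα? : ∀ n i j → Dec (degα< n i j)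
    degα? n i j = (i ℕ.<? n) ×-dec (j ℕ.<? 1)
    ≤-pred-or : ∀ {i n} → i < suc n → i < n ⊎ i ≡ n
    ≤-pred-or lt = ℕ.m≤n⇒m<n∨m≡n (ℕ.s≤s⁻¹ lt)

  open Domains polyRing using (Filtration)

  filtrationβ : Filtration (λ n → Supp (degβ< n)) βP
  filtrationβ = record
    { D-resp = supp-resp ; D-+ = supp-+ ; D-neg = supp-neg
    ; D-≤ = λ m≤n → supp-⊆ (λ lt → ℕ.≤-trans lt m≤n)
    ; D-0 = λ s → coeffwise λ i j → s .off i j λ ()
    ; D-0# = supp-0 ; D-1 = supp-mono (s≤s z≤n) ; D-X = supp-mono (s≤s (s≤s z≤n))
    ; D-* = λ {m} {n} → supp-* (degβ? m) (degβ? (suc n)) (λ j<m l≤n → ℕ.+-mono-≤ j<m (ℕ.s≤s⁻¹ l≤n))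
    ; split = split
    ; indep = indep }
    where
    split : ∀ {n p} → Supp (degβ< (suc n)) p →
      ∃₂ λ p′ a → Supp (degβ< n) p′ × Supp (degβ< 1) a × p ≋ p′ + a * βP ^ n
    split {n} {p} s =
      let top? = λ i j → j ℕ.≟ n
          a , Da , e = divide-mono 0 n (restrict top? p)
            (All.map (λ { {_ , i , _} refl → i , 0 , ≡.sym (ℕ.+-identityʳ i) , refl , s≤s z≤n }) (restrict-All top? p))
      in restrict (degβ? n) p , a , All⇒Supp _ (restrict-All (degβ? n) p) , Da ,
         trans (partition (degβ? n) top? (λ { lt refl → ℕ.<-irrefl refl lt }) (supp-⊆ ≤-pred-or s))
               (+-congˡ (trans e (*-congˡ (sym (β^ n)))))
    indep : ∀ {n p a} → Supp (degβ< n) p → Supp (degβ< 1) a → p ≋ a * βP ^ n → a ≋ 0P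
    indep {n} {p} {a} Dp Da e .at i (suc j) = Da .off i (suc j) λ { (s≤s ()) }
    indep {n} {p} {a} Dp Da e .at i zero =
      R.trans (R.sym (coeff-*-mono a 0 n i 0))
        (R.trans (R.sym (trans e (*-congˡ (β^ n)) .at (i ℕ.+ 0) n)) (Dp .off (i ℕ.+ 0) n (ℕ.<-irrefl refl)))

  filtrationα : Filtration (λ n → Supp (degα< n)) αP
  filtrationα = record
    { D-resp = supp-resp ; D-+ = supp-+ ; D-neg = supp-neg
    ; D-≤ = λ m≤n → supp-⊆ (λ (lt , lt′) → ℕ.≤-trans lt m≤n , lt′)
    ; D-0 = λ s → coeffwise λ i j → s .off i j λ ()
    ; D-0# = supp-0 ; D-1 = supp-mono (s≤s z≤n , s≤s z≤n) ; D-X = supp-mono (s≤s (s≤s z≤n) , s≤s z≤n)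
    ; D-* = λ {m} {n} → supp-* (degα? m) (degα? (suc n))
        (λ { (i<m , s≤s z≤n) (k≤n , s≤s z≤n) → ℕ.+-mono-≤ i<m (ℕ.s≤s⁻¹ k≤n) , s≤s z≤n })
    ; split = split
    ; indep = indep }
    where
    split : ∀ {n p} → Supp (degα< (suc n)) p →
      ∃₂ λ p′ a → Supp (degα< n) p′ × Supp (degα< 1) a × p ≋ p′ + a * αP ^ n
    split {n} {p} s =
      let top? = λ i j → (i ℕ.≟ n) ×-dec (j ℕ.<? 1)
          a , Da , e = divide-mono n 0 (restrict top? p)
            (All.map (λ { {_ , _ , j} (refl , lt) → 0 , j , refl , ≡.sym (ℕ.+-identityʳ j) , s≤s z≤n , lt }) (restrict-All top? p))
      in restrict (degα? n) p , a , All⇒Supp _ (restrict-All (degα? n) p) , Da ,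
         trans (partition (degα? n) top? (λ { (lt , _) (refl , _) → ℕ.<-irrefl refl lt })
                 (supp-⊆ (λ (lt , lt′) → case-⊎ lt′ (≤-pred-or lt)) s))
               (+-congˡ (trans e (*-congˡ (sym (α^ n)))))
      where
      case-⊎ : ∀ {i j n} → j < 1 → i < n ⊎ i ≡ n → (i < n × j < 1) ⊎ (i ≡ n × j < 1)
      case-⊎ lt (inj₁ x) = inj₁ (x , lt)
      case-⊎ lt (inj₂ x) = inj₂ (x , lt)
    indep : ∀ {n p a} → Supp (degα< n) p → Supp (degα< 1) a → p ≋ a * αP ^ n → a ≋ 0P
    indep {n} {p} {a} Dp Da e .at (suc i) j = Da .off (suc i) j λ { (s≤s () , _) }
    indep {n} {p} {a} Dp Da e .at zero (suc j) = Da .off 0 (suc j) λ { (_ , s≤s ()) }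
    indep {n} {p} {a} Dp Da e .at zero zero =
      R.trans (R.sym (coeff-*-mono a n 0 0 0))
        (R.trans (R.sym (trans e (*-congˡ (α^ n)) .at n 0)) (Dp .off n 0 (ℕ.<-irrefl refl ∘ proj₁)))

  constant-≋ : ∀ {p} → Supp (degα< 1) p → p ≋ constP (coeff p 0 0)
  constant-≋ s .at zero zero = R.sym (R.+-identityʳ _)
  constant-≋ s .at zero (suc j) = s .off 0 (suc j) λ { (_ , s≤s ()) }
  constant-≋ s .at (suc i) j = s .off (suc i) j λ { (s≤s () , _) }

  -- Exchanging α and β turns elimination of β into elimination of α.
  swapP : Poly → Poly
  swapP = map λ (a , i , j) → a , j , i

  coeff-swap : ∀ p i j → coeff (swapP p) i j ≈ coeff p j i
  coeff-swap [] i j = R.refl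
  coeff-swap ((a , k , l) ∷ p) i j = R.trans (coeff-∷ a l k (swapP p) i j)
    (R.trans (R.+-cong swapped (coeff-swap p i j)) (R.sym (coeff-∷ a k l p j i)))
    where
    swapped : coeff (mono a l k) i j ≈ coeff (mono a k l) j i
    swapped with k ℕ.≟ j | l ℕ.≟ i
    ... | yes _ | yes _ = R.refl
    ... | yes _ | no _  = R.refl
    ... | no _  | yes _ = R.refl
    ... | no _  | no _  = R.refl

  swap-cong : ∀ {p q} → p ≋ q → swapP p ≋ swapP q
  swap-cong {p} {q} e .at i j = R.trans (coeff-swap p i j) (R.trans (e .at j i) (R.sym (coeff-swap q i j)))

  swap-involutive : ∀ p → swapP (swapP p) ≋ p
  swap-involutive p .at i j = R.trans (coeff-swap (swapP p) i j) (coeff-swap p j i)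

  swap-+ : ∀ p q → swapP (p + q) ≋ swapP p + swapP q
  swap-+ p q = reflexive (≡.trans (cong swapP (⊕≡ p q)) (≡.trans (map-++ _ p q) (≡.sym (⊕≡ _ _))))

  swap-* : ∀ p q → swapP (p * q) ≋ swapP p * swapP q
  swap-* p q = reflexive (≡.trans (cong swapP (·≡ p q)) (≡.trans (go p) (≡.sym (·≡ _ _))))
    where
    scaled : ∀ a i j q → swapP (scale a i j q) ≡ scale a j i (swapP q)
    scaled a i j [] = refl
    scaled a i j (_ ∷ q) = cong (_ ∷_) (scaled a i j q)
    go : ∀ p → swapP (p *P q) ≡ swapP p *P swapP q
    go [] = refl
    go ((a , i , j) ∷ p) = ≡.trans (cong swapP (∷-* a i j p q)) (≡.trans (map-++ _ (scale a i j q) (p *P q))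
      (≡.trans (cong₂ _++_ (scaled a i j q) (go p)) (≡.sym (∷-* a j i (swapP p) (swapP q)))))

  supp-swap : ∀ {P Q p} → (∀ {i j} → P i j → Q j i) → Supp P p → Supp Q (swapP p)
  supp-swap {p = p} f s .off i j ¬Q = R.trans (coeff-swap p i j) (s .off j i (¬Q ∘ f))

-- Greatest common divisors in F[α,β].

module OverField {c ℓ} (F : CommutativeRing c ℓ) (isField : IsField F) where
  private module F = CommutativeRing F
  open F using () renaming (0# to 0F; 1# to 1F)
  open Poly2 F
  open Polynomials F
  open Support F
  open CommutativeRing polyRing hiding (_≈_; _≉_; 0#; 1#; zero) renaming (refl to ≋refl)
  open import Algebra.Properties.Semiring.Exp semiring using (_^_)
  open Domains polyRing

  constP-unit : ∀ {x y} → x F.* y F.≈ 1F → constP x * constP y ≋ 1P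
  constP-unit xy≈1 = trans (reflexive (·≡ _ _)) (mono-cong 0 0 xy≈1)

  constP≋0 : ∀ {a} → a F.≈ 0F → constP a ≋ 0P
  constP≋0 a≈0 .at zero zero = F.trans (F.+-identityʳ _) a≈0
  constP≋0 a≈0 .at zero (suc j) = F.refl
  constP≋0 a≈0 .at (suc i) j = F.refl

  constant-unit : ∀ {p} → Supp (degα< 1) p → p ≉ 0P → Unit p
  constant-unit {p} s p≉0 =
    let y , ay≈1 = proj₂ isField (coeff p 0 0) (λ a≈0 → p≉0 (trans (constant-≋ s) (constP≋0 a≈0)))
    in constP y , trans (*-congʳ (constant-≋ s)) (constP-unit ay≈1)

  private
    degα-bound : ∀ {n p} → Supp (degβ< 1) p → Supp (Total< n) p → Supp (degα< n) p
    degα-bound s t .off i j ne with j ℕ.<? 1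
    ... | no j≮1 = s .off i j j≮1
    ... | yes j<1 = t .off i j λ lt → ne (ℕ.≤-trans (s≤s (ℕ.m≤m+n i j)) lt , j<1)

    degα-exhaust : ∀ {p} → Supp (degβ< 1) p → ∃ λ n → Supp (degα< n) p
    degα-exhaust {p} s = proj₁ (bounded p) , degα-bound s (proj₂ (bounded p))

    degβ-exhaust : ∀ p → ∃ λ n → Supp (degβ< n) p
    degβ-exhaust p = proj₁ (bounded p) , supp-⊆ (λ {i} lt → ℕ.≤-trans (s≤s (ℕ.m≤n+m _ i)) lt) (proj₂ (bounded p))

  open TwoVariables filtrationα filtrationβ (supp-⊆ proj₂) degα-exhaust degβ-exhaust constant-unit public

  private
    module A = Filtration filtrationα
    module B = Filtration filtrationβ

  1P≉0 : 1P ≉ 0P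
  1P≉0 e = proj₁ isField (F.sym (F.trans (F.sym (F.+-identityʳ 1F)) (e .at 0 0)))

  -- Connects the abstract leading monomial with `coeff`, in terms of which `PosDeg` and `Total<`
  -- bounds are expressed.
  LM-coefficient : ∀ {p k n} → LM p k n → ¬ (coeff p k n F.≈ 0F)
  LM-coefficient {p} {k} {n} (a , u , (Da , p′ , Dp′ , p≈) , (Du , a′ , Da′ , a≈) , u≉0) pkn≈0 =
    u≉0 (trans (constant-≋ Du) (constP≋0 (F.trans (F.sym coeff-top) pkn≈0)))
    where
    coeff-top : coeff p k n F.≈ coeff u 0 0
    coeff-top = begin
      coeff p k n                                 ≈⟨ trans p≈ (+-congˡ (*-congˡ (β^ n))) .at k n ⟩
      coeff (p′ + a * mono 1F 0 n) k n            ≈⟨ coeff-⊕ p′ _ k n ⟩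
      coeff p′ k n F.+ coeff (a * mono 1F 0 n) k n ≈⟨ F.+-cong (Dp′ .off k n (ℕ.<-irrefl refl))
        (subst (λ m → coeff (a * mono 1F 0 n) m n F.≈ coeff a k 0) (ℕ.+-identityʳ k) (coeff-*-mono a 0 n k 0)) ⟩
      0F F.+ coeff a k 0                          ≈⟨ F.+-identityˡ _ ⟩
      coeff a k 0                                 ≈⟨ trans a≈ (+-congˡ (*-congˡ (α^ k))) .at k 0 ⟩
      coeff (a′ + u * mono 1F k 0) k 0            ≈⟨ coeff-⊕ a′ _ k 0 ⟩
      coeff a′ k 0 F.+ coeff (u * mono 1F k 0) k 0 ≈⟨ F.+-cong (Da′ .off k 0 (ℕ.<-irrefl refl ∘ proj₁)) (coeff-*-mono u k 0 0 0) ⟩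
      0F F.+ coeff u 0 0                          ≈⟨ F.+-identityˡ _ ⟩
      coeff u 0 0                                 ∎
      where open import Relation.Binary.Reasoning.Setoid F.setoid

  LM⇒PosDeg : ∀ {p k n} → LM p k n → 0 < k ℕ.+ n → PosDeg p
  LM⇒PosDeg L lt = _ , _ , lt , LM-coefficient L

  LM-bound : ∀ {N p k n} → Supp (Total< N) p → LM p k n → k ℕ.+ n < N
  LM-bound {N} {p} {k} {n} s L with (k ℕ.+ n) ℕ.<? N
  ... | yes lt = lt
  ... | no ≮ = ⊥-elim (LM-coefficient L (s .off k n ≮))

  swap-∣ : ∀ {x y} → x ∣ swapP y → swapP x ∣ y
  swap-∣ {x} {y} (e , xe≈) = swapP e ,
    trans (sym (swap-* x e)) (trans (swap-cong xe≈) (swap-involutive y))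

  swap-≉0 : ∀ {x} → x ≉ 0P → swapP x ≉ 0P
  swap-≉0 {x} x≉0 e = x≉0 (trans (sym (swap-involutive x)) (swap-cong e))

  -- Elimination is applied to the pair and to its image under `swapP`. Swapping back the second
  -- outcome gives an element of F[β] whose leading coefficient is a nonzero constant, hence a unit.
  coprime-or-common-factor : ∀ {x y} → x ≉ 0P → y ≉ 0P → ¬ ¬ (Coprime x y ⊎ CommonFactor x y)
  coprime-or-common-factor {x} {y} x≉0 y≉0 = meets-or-common-factor x≉0 y≉0 >>= λ where
      (inj₂ common) → return (inj₂ common)
      (inj₁ meets) → meets-or-common-factor (swap-≉0 x≉0) (swap-≉0 y≉0) >>= λ where
        (inj₂ (g , nonconst , g∣x , g∣y)) → return (inj₂ (swapP g ,
          (λ s → nonconst (supp-resp (swap-involutive g) (supp-swap (λ (i<1 , j<1) → j<1 , i<1) s))) ,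
          swap-∣ g∣x , swap-∣ g∣y))
        (inj₁ (l , s , t , Dl , l≉0 , l≈)) →
          A.lead _ (proj₂ (degα-exhaust Dl)) l≉0 >>= λ (k , u , (Du , l′ , Dl′ , l≈′) , u≉0) →
          regular x≉0 >>= λ regx →
          meets-both⇒coprime regx meets
            (swapP s , swapP t , trans (+-cong (unswap s x) (unswap t y))
              (trans (sym (swap-+ (s * swapP x) (t * swapP y))) (swap-cong l≈)))
            (supp-swap proj₁ Du , swapP l′ , supp-swap proj₁ Dl′ , trans (swap-cong l≈′)
              (trans (swap-+ l′ (u * αP ^ k)) (+-congˡ (trans (swap-* u (αP ^ k))
                (*-congˡ (trans (swap-cong (α^ k)) (sym (β^ k))))))))
            (constant-unit (supp-swap (λ (i<1 , j<1) → j<1 , i<1) Du) (swap-≉0 u≉0)) >>= λ coprime →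
          return (inj₁ coprime)
    where
    unswap : ∀ s x → swapP s * x ≋ swapP (s * swapP x)
    unswap s x = sym (trans (swap-* s (swapP x)) (*-congˡ (swap-involutive x)))

  record CoprimeParts (p q : Poly) : Set (c ⊔ ℓ) where
    field
      {d x y} : Poly
      p≈dx    : p ≋ d * x
      q≈dy    : q ≋ d * y
      coprime : Coprime x y

  -- Split off common factors as long as possible; the leading monomial of the
  -- factor found so far grows but stays below the degree of p.
  coprime-parts : ∀ {p q} → p ≉ 0P → q ≉ 0P → ¬ ¬ CoprimeParts p q
  coprime-parts {p} {q} p≉0 q≉0 = LM-exists 1P≉0 >>= λ (k , n , L) →
    loop N L (ℕ.m≤m+n N _) (sym (*-identityˡ p)) (sym (*-identityˡ q))
    where
    N = proj₁ (bounded p)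
    loop : ∀ fuel {d x y k n} → LM d k n → N ≤ fuel ℕ.+ (k ℕ.+ n) → p ≋ d * x → q ≋ d * y → ¬ ¬ CoprimeParts p q
    loop fuel {d} {x} {y} {k} {n} Ld N≤ p≈ q≈ =
      let x≉0 = factor≉0ʳ (sym p≈) p≉0
          y≉0 = factor≉0ʳ (sym q≈) q≉0
      in coprime-or-common-factor x≉0 y≉0 >>= λ where
        (inj₁ coprime) → return record { p≈dx = p≈ ; q≈dy = q≈ ; coprime = coprime }
        (inj₂ (g , nonconst , (x′ , gx′≈x) , (y′ , gy′≈y))) →
          LM-exists x≉0 >>= λ (k₁ , n₁ , Lx) →
          LM-exists (factor≉0ˡ gx′≈x x≉0) >>= λ (k₂ , n₂ , Lg) →
          next fuel N≤ (LM-bound (proj₂ (bounded p)) (LM-resp (sym p≈) (LM-* Ld Lx)))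
            (LM-* Ld Lg) (nonconstant⇒LM-positive Lg nonconst)
            (trans p≈ (trans (*-congˡ (sym gx′≈x)) (sym (*-assoc d g x′))))
            (trans q≈ (trans (*-congˡ (sym gy′≈y)) (sym (*-assoc d g y′))))
      where
      next : ∀ fuel {d x y k₁ n₁ k₂ n₂} → N ≤ fuel ℕ.+ (k ℕ.+ n) → (k ℕ.+ k₁) ℕ.+ (n ℕ.+ n₁) < N →
        LM d (k ℕ.+ k₂) (n ℕ.+ n₂) → 0 < k₂ ℕ.+ n₂ → p ≋ d * x → q ≋ d * y → ¬ ¬ CoprimeParts p q
      -- Without fuel the leading monomial of the old `d` alone reaches degree `N`, although its
      -- product with that of `x` is the leading monomial of `p`.
      next zero {k₁ = k₁} {n₁} N≤ <N _ _ _ _ =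
        ⊥-elim (ℕ.<⇒≱ <N (ℕ.≤-trans N≤ (ℕ.+-mono-≤ (ℕ.m≤m+n k k₁) (ℕ.m≤m+n n n₁))))
      next (suc fuel) {k₂ = k₂} {n₂} N≤ _ Ld pos p≈ q≈ = loop fuel Ld (begin
        N                                           ≤⟨ N≤ ⟩
        suc fuel ℕ.+ (k ℕ.+ n)                      ≡⟨ ℕ.+-suc fuel (k ℕ.+ n) ⟨
        fuel ℕ.+ suc (k ℕ.+ n)                      ≡⟨ cong (fuel ℕ.+_) (ℕ.+-comm 1 (k ℕ.+ n)) ⟩
        fuel ℕ.+ ((k ℕ.+ n) ℕ.+ 1)                  ≤⟨ ℕ.+-monoʳ-≤ fuel (ℕ.+-monoʳ-≤ (k ℕ.+ n) pos) ⟩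
        fuel ℕ.+ ((k ℕ.+ n) ℕ.+ (k₂ ℕ.+ n₂))        ≡⟨ cong (fuel ℕ.+_) (ℕ-interchange k n k₂ n₂) ⟩
        fuel ℕ.+ ((k ℕ.+ k₂) ℕ.+ (n ℕ.+ n₂))        ∎) p≈ q≈
        where
        open ℕ.≤-Reasoning

  -- If `p` is `e * f` and `q` is `e * g`, cancelling `d` gives `x * g ≋ y * f`. Coprimality then
  -- makes `f` a multiple `x * z`, and cancelling `x` leaves `e * z ≋ d`.
  coprime-parts⇒gcd : ∀ {p q} → p ≉ 0P → (parts : CoprimeParts p q) → ¬ ¬ IsGCD (CoprimeParts.d parts) p q
  coprime-parts⇒gcd {p} {q} p≉0 parts =
    regular (factor≉0ˡ (sym p≈dx) p≉0) >>= λ reg-d →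
    regular (factor≉0ʳ (sym p≈dx) p≉0) >>= λ reg-x →
    return ((x , ≃* d x p≈dx) , (y , ≃* d y q≈dy) , λ e (f , ef≈p) (g , eg≈q) →
      let ef≋p = trans (reflexive (·≡ e f)) (coeffwise ef≈p)
          eg≋q = trans (reflexive (·≡ e g)) (coeffwise eg≈q)
          z , xz≈f = coprime f g (cancel reg-d (begin
            d * (x * g)   ≈⟨ *-assoc d x g ⟨
            (d * x) * g   ≈⟨ *-congʳ (trans (sym p≈dx) (sym ef≋p)) ⟩
            (e * f) * g   ≈⟨ regroup₁ e f g ⟩
            (e * g) * f   ≈⟨ *-congʳ (trans eg≋q q≈dy) ⟩
            (d * y) * f   ≈⟨ *-assoc d y f ⟩
            d * (y * f)   ∎))
      in z , trans (sym (reflexive (·≡ e z))) (cancel reg-x (begin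
           x * (e * z)   ≈⟨ regroup₂ x e z ⟩
           e * (x * z)   ≈⟨ *-congˡ xz≈f ⟩
           e * f         ≈⟨ ef≋p ⟩
           p             ≈⟨ p≈dx ⟩
           d * x         ≈⟨ *-comm d x ⟩
           x * d         ∎)) .at)
    where
    open CoprimeParts parts
    open import Relation.Binary.Reasoning.Setoid setoid
    open import Algebra.Solver.Ring.NaturalCoefficients.Default commutativeSemiring using (solve; _:=_; _:*_)
    ≃* : ∀ d x {p} → p ≋ d * x → (d *P x) ≃ p
    ≃* d x e = sym (trans e (reflexive (·≡ d x))) .at
    regroup₁ = solve 3 (λ e f g → (e :* f) :* g := (e :* g) :* f) ≋refl
    regroup₂ = solve 3 (λ x e z → x :* (e :* z) := e :* (x :* z)) ≋refl

-- Ring homomorphisms and the inverse of σ on F.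

module _ {a b ℓ₁ ℓ₂} (A : CommutativeRing a ℓ₁) (B : CommutativeRing b ℓ₂) where
  private
    module A = CommutativeRing A
    module B = CommutativeRing B
  open import Algebra.Properties.Group B.+-group using (identityˡ-unique; inverseˡ-unique)

  IsHom : (A.Carrier → B.Carrier) → Set (a ⊔ ℓ₁ ⊔ ℓ₂)
  IsHom = RingMorphisms.IsRingHomomorphism A.rawRing B.rawRing

  isHom : ∀ {f} → (∀ {x y} → x A.≈ y → f x B.≈ f y) →
    (∀ x y → f (x A.+ y) B.≈ f x B.+ f y) → (∀ x y → f (x A.* y) B.≈ f x B.* f y) →
    f A.1# B.≈ B.1# → IsHom f
  isHom {f} f-cong f-+ f-* f-1 = record
    { isSemiringHomomorphism = record
      { isNearSemiringHomomorphism = record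
        { +-isMonoidHomomorphism = record
          { isMagmaHomomorphism = record
            { isRelHomomorphism = record { cong = f-cong }
            ; homo = f-+ }
          ; ε-homo = f-0 }
        ; *-homo = f-* }
      ; 1#-homo = f-1 }
    ; -‿homo = λ x → inverseˡ-unique (f (A.- x)) (f x)
        (B.trans (B.sym (f-+ (A.- x) x)) (B.trans (f-cong (A.-‿inverseˡ x)) f-0)) }
    where
    f-0 : f A.0# B.≈ B.0#
    f-0 = identityˡ-unique _ _ (B.trans (B.sym (f-+ A.0# A.0#)) (f-cong (A.+-identityˡ A.0#)))

module InverseHom {c ℓ} (F : CommutativeRing c ℓ) {σ} (aut : IsAutomorphism F σ) where
  open CommutativeRing F renaming (refl to ≈refl)
  open RingMorphisms.IsRingIsomorphism aut

  σ⁻¹ : Carrier → Carrier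
  σ⁻¹ y = proj₁ (surjective y)

  σσ⁻¹ : ∀ x → σ (σ⁻¹ x) ≈ x
  σσ⁻¹ x = proj₂ (surjective x) ≈refl

  σ⁻¹σ : ∀ x → σ⁻¹ (σ x) ≈ x
  σ⁻¹σ x = injective (σσ⁻¹ (σ x))

  σ⁻¹-hom : IsHom F F σ⁻¹
  σ⁻¹-hom = isHom F F
    (λ x≈y → injective (trans (σσ⁻¹ _) (trans x≈y (sym (σσ⁻¹ _)))))
    (λ x y → injective (trans (σσ⁻¹ _) (sym (trans (+-homo _ _) (+-cong (σσ⁻¹ x) (σσ⁻¹ y))))))
    (λ x y → injective (trans (σσ⁻¹ _) (sym (trans (*-homo _ _) (*-cong (σσ⁻¹ x) (σσ⁻¹ y))))))
    (injective (trans (σσ⁻¹ _) (sym 1#-homo)))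

-- Endomorphisms of F[α,β] given by substitution.

module Substitution {c ℓ} (F : CommutativeRing c ℓ) where
  private module F = CommutativeRing F
  open F using () renaming (0# to 0F; 1# to 1F)
  open Poly2 F
  open Polynomials F
  open Support F
  open CommutativeRing polyRing hiding (_≈_; _≉_; 0#; 1#; zero; Carrier) renaming (refl to ≋refl)
  open import Algebra.Properties.Semiring.Exp semiring using (_^_; ^-homo-*; ^-cong)
  open import Algebra.Solver.Ring.NaturalCoefficients.Default commutativeSemiring using (solve; _:=_; _:*_)

  constP-hom : IsHom F polyRing constP
  constP-hom = isHom F polyRing (mono-cong 0 0)
    (λ x y → trans (coeffwise (const-+ x y)) (reflexive (≡.sym (⊕≡ (constP x) (constP y)))))
    (λ x y → reflexive (≡.sym (·≡ (constP x) (constP y))))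
    ≋refl
    where
    const-+ : ∀ x y → constP (x F.+ y) ≃ (constP x +P constP y)
    const-+ x y zero zero = F.+-assoc x y 0F
    const-+ x y zero (suc j) = F.refl
    const-+ x y (suc i) j = F.refl

  mono-factor : ∀ a i j → mono a i j ≋ constP a * (αP ^ i * βP ^ j)
  mono-factor a i j = sym (trans (*-congˡ (*-cong (α^ i) (β^ j)))
    (trans (*-congˡ (reflexive (·≡ (mono 1F i 0) (mono 1F 0 j))))
    (trans (reflexive (·≡ (constP a) _))
    (trans (mono-cong (i ℕ.+ 0) j (F.trans (F.*-congˡ (F.*-identityˡ 1F)) (F.*-identityʳ a)))
           (reflexive (cong (λ k → mono a k j) (ℕ.+-identityʳ i)))))))

  End : (Poly → Poly) → Set (c ⊔ ℓ)
  End = IsHom polyRing polyRing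

  module End {f} (hom : End f) where
    open RingMorphisms.IsRingHomomorphism hom public

    ^-homo : ∀ p n → f (p ^ n) ≋ f p ^ n
    ^-homo p zero = 1#-homo
    ^-homo p (suc n) = trans (*-homo p (p ^ n)) (*-congˡ (^-homo p n))

  -- Reduces `τσ` and `στ` to checks on constants, α and β.
  end-ext : ∀ {f g} → End f → End g → (∀ a → f (constP a) ≋ g (constP a)) →
    f αP ≋ g αP → f βP ≋ g βP → ∀ p → f p ≋ g p
  end-ext {f} {g} f-hom g-hom const α β = go
    where
    module f = End f-hom
    module g = End g-hom
    expand : ∀ {h} (hom : End h) a i j → h (constP a * (αP ^ i * βP ^ j)) ≋ h (constP a) * (h αP ^ i * h βP ^ j)
    expand hom a i j = trans (h.*-homo _ _) (*-congˡ (trans (h.*-homo _ _) (*-cong (h.^-homo αP i) (h.^-homo βP j))))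
      where module h = End hom
    term : ∀ a i j → f (mono a i j) ≋ g (mono a i j)
    term a i j = trans (f.⟦⟧-cong (mono-factor a i j)) (trans (expand f-hom a i j)
      (trans (*-cong (const a) (*-cong (^-cong α (refl {x = i})) (^-cong β (refl {x = j}))))
        (sym (trans (g.⟦⟧-cong (mono-factor a i j)) (expand g-hom a i j)))))
    go : ∀ p → f p ≋ g p
    go [] = trans f.0#-homo (sym g.0#-homo)
    go ((a , i , j) ∷ p) =
      let split = reflexive (≡.sym (⊕≡ (mono a i j) p)) in
      trans (f.⟦⟧-cong split) (trans (f.+-homo _ p) (trans (+-cong (term a i j) (go p))
        (sym (trans (g.⟦⟧-cong split) (g.+-homo _ p)))))

  total-* : ∀ {m n p q} → Supp (Total< (suc m)) p → Supp (Total< (suc n)) q → Supp (Total< (suc (m ℕ.+ n))) (p * q)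
  total-* {m} {n} = supp-* (λ i j → (i ℕ.+ j) ℕ.<? suc m) (λ i j → (i ℕ.+ j) ℕ.<? suc n)
    (λ {i} {j} {k} {l} p q → s≤s (subst (_≤ m ℕ.+ n) (ℕ-interchange i j k l) (ℕ.+-mono-≤ (ℕ.s≤s⁻¹ p) (ℕ.s≤s⁻¹ q))))

  total-^ : ∀ {p} → Supp (Total< 2) p → ∀ n → Supp (Total< (suc n)) (p ^ n)
  total-^ s zero = supp-mono (s≤s z≤n)
  total-^ s (suc n) = total-* s (total-^ s n)

  -- The coefficients are twisted by `h` because σ is not F-linear; `σP` and its inverse `τP` are
  -- both of this kind.
  module Evaluation {h} (h-hom : IsHom F F h) (x y : Poly) where
    open Functional polyRing (Composition.isRingHomomorphism trans h-hom constP-hom)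
    private module h = RingMorphisms.IsRingHomomorphism h-hom

    eval : Poly → Poly
    eval p = ⟨ p , (λ i j → x ^ i * y ^ j) ⟩

    eval-cong : ∀ {p q} → p ≋ q → eval p ≋ eval q
    eval-cong {p} {q} e = ⟨⟩-congˡ p q _ (e .at)

    eval-const : ∀ a → eval (constP a) ≋ constP (h a)
    eval-const a = trans (+-identityʳ _) (trans (*-congˡ (*-identityˡ 1P)) (*-identityʳ _))

    eval-hom : End eval
    eval-hom = isHom polyRing polyRing eval-cong
      (λ p q → trans (eval-cong (reflexive (⊕≡ p q))) (⟨⟩-++ p q _))
      (λ p q → trans (eval-cong (reflexive (·≡ p q))) (⟨⟩-*-homo multiplicative p q))
      (trans (eval-const 1F) (mono-cong 0 0 h.1#-homo))
      where
      regroup = solve 4 (λ a b c d → (a :* c) :* (b :* d) := (a :* b) :* (c :* d)) ≋refl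
      multiplicative : ∀ i j k l → x ^ (i ℕ.+ k) * y ^ (j ℕ.+ l) ≋ (x ^ i * y ^ j) * (x ^ k * y ^ l)
      multiplicative i j k l = trans (*-cong (^-homo-* x i k) (^-homo-* y j l))
        (regroup (x ^ i) (y ^ j) (x ^ k) (y ^ l))

    private
      h1 : constP (h 1F) ≋ 1P
      h1 = mono-cong 0 0 h.1#-homo

    eval-α : eval αP ≋ x
    eval-α = trans (+-identityʳ _) (trans (*-cong h1 (*-identityʳ _)) (trans (*-identityˡ _) (*-identityʳ x)))

    eval-β : eval βP ≋ y
    eval-β = trans (+-identityʳ _) (trans (*-cong h1 (*-identityˡ _)) (trans (*-identityˡ _) (*-identityʳ y)))

    eval-total : Supp (Total< 2) x → Supp (Total< 2) y → ∀ {N p} → Supp (Total< N) p → Supp (Total< N) (eval p)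
    eval-total sx sy {N} {p} s =
      -- The induction runs over the terms of the list, so those beyond the bound, which cancel,
      -- have to be removed first.
      supp-resp (sym (eval-cong {p} {restrict total? p} (coeffwise (restrict-≃ total? p s))))
        (go (restrict total? p) (restrict-All total? p))
      where
      total? : ∀ i j → Dec (Total< N i j)
      total? i j = (i ℕ.+ j) ℕ.<? N
      go : ∀ p → All (OnTerm (Total< N)) p → Supp (Total< N) (eval p)
      go [] [] = supp-0
      go ((a , i , j) ∷ p) (lt ∷ ps) = supp-+
        (supp-⊆ (λ lt′ → ℕ.≤-trans lt′ lt)
          (total-* {0} (supp-mono (s≤s z≤n)) (total-* (total-^ sx i) (total-^ sy j))))
        (go p ps)

-- The extension of σ to F[α,β] and its inverse.

module ShiftMap {c ℓ} (F : CommutativeRing c ℓ) (isField : IsField F)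
  {σ : CommutativeRing.Carrier F → CommutativeRing.Carrier F} (aut : IsAutomorphism F σ)
  {u v : CommutativeRing.Carrier F} (u≉0 : ¬ CommutativeRing._≈_ F u (CommutativeRing.0# F)) where
  private module F = CommutativeRing F
  open F using () renaming (0# to 0F; 1# to 1F)
  open Poly2 F
  open Shift σ u v
  open Polynomials F
  open Support F
  open Substitution F
  open InverseHom F aut
  open CommutativeRing polyRing hiding (_≈_; _≉_; 0#; 1#; zero; Carrier) renaming (refl to ≋refl)
  open import Algebra.Properties.Semiring.Exp semiring using (_^_)
  open import Algebra.Solver.Ring.NaturalCoefficients.Default commutativeSemiring using (solve; _:=_; _:*_; _:+_)
  open import Relation.Binary.Reasoning.Setoid setoid
  private
    module σ = RingMorphisms.IsRingIsomorphism aut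
    module σ⁻¹ = RingMorphisms.IsRingHomomorphism σ⁻¹-hom
    module const = RingMorphisms.IsRingHomomorphism constP-hom

    σβ : Poly
    σβ = (constP u *P αP) +P (constP v *P βP)

    σβ≋ : σβ ≋ constP u * αP + constP v * βP
    σβ≋ = reflexive (≡.sym (≡.trans (⊕≡ _ _) (cong₂ _+P_ (·≡ (constP u) αP) (·≡ (constP v) βP))))

    module σE = Evaluation σ.isRingHomomorphism βP σβ

    ^P≡ : ∀ p n → p ^P n ≡ p ^ n
    ^P≡ p zero = refl
    ^P≡ p (suc n) = ≡.trans (cong (p *P_) (^P≡ p n)) (≡.sym (·≡ p (p ^ n)))

    -- Both recursions build the same list, so `σP` inherits every property of evaluation.
    σP≡ : ∀ p → σP p ≡ σE.eval p
    σP≡ [] = refl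
    σP≡ ((a , i , j) ∷ p) = ≡.trans
      (cong₂ _+P_
        (≡.trans (cong (constP (σ a) *P_) (≡.trans (cong₂ _*P_ (^P≡ βP i) (^P≡ σβ j)) (≡.sym (·≡ _ _))))
                 (≡.sym (·≡ _ _)))
        (σP≡ p))
      (≡.sym (⊕≡ _ _))

    σP≋ : ∀ p → σP p ≋ σE.eval p
    σP≋ p = reflexive (σP≡ p)

  σP-cong : ∀ {p q} → p ≋ q → σP p ≋ σP q
  σP-cong {p} {q} e = trans (σP≋ p) (trans (σE.eval-cong {p} {q} e) (sym (σP≋ q)))

  σP-hom : End σP
  σP-hom = isHom polyRing polyRing σP-cong
    (λ p q → trans (σP≋ (p + q)) (trans (E.+-homo p q) (sym (+-cong (σP≋ p) (σP≋ q)))))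
    (λ p q → trans (σP≋ (p * q)) (trans (E.*-homo p q) (sym (*-cong (σP≋ p) (σP≋ q)))))
    (trans (σP≋ 1P) E.1#-homo)
    where module E = End σE.eval-hom

  σP-total : ∀ {N p} → Supp (Total< N) p → Supp (Total< N) (σP p)
  σP-total {p = p} s = supp-resp (sym (σP≋ p)) (σE.eval-total (supp-mono (s≤s (s≤s z≤n)))
    (supp-resp (sym σβ≋) (supp-+ (linear u (s≤s (s≤s z≤n))) (linear v (s≤s (s≤s z≤n))))) s)
    where
    linear : ∀ a {i j} → Total< 2 i j → Supp (Total< 2) (constP a * mono 1F i j)
    linear a lt = total-* {0} {1} (supp-mono (s≤s z≤n)) (supp-mono lt)

  private
    u⁻¹ w : F.Carrier
    u⁻¹ = proj₁ (proj₂ isField u u≉0)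
    w = σ⁻¹ u⁻¹

    uu⁻¹≈1 : u F.* u⁻¹ F.≈ 1F
    uu⁻¹≈1 = proj₂ (proj₂ isField u u≉0)

    -- Applying σ⁻¹ to σ(β) = uα + vβ gives β = σ⁻¹(u) τ(α) + σ⁻¹(v) α; this is its solution for
    -- τ(α), with `w` the inverse of σ⁻¹(u).
    τα : Poly
    τα = constP w * (βP + constP (F.- σ⁻¹ v) * αP)

    module τE = Evaluation σ⁻¹-hom τα αP

  τP : Poly → Poly
  τP = τE.eval

  τP-hom : End τP
  τP-hom = τE.eval-hom

  private
    module σH = End σP-hom
    module τH = End τP-hom

    σ-const : ∀ a → σP (constP a) ≋ constP (σ a)
    σ-const a = trans (σP≋ (constP a)) (σE.eval-const a)
    σ-α : σP αP ≋ βP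
    σ-α = trans (σP≋ αP) σE.eval-α
    σ-β : σP βP ≋ constP u * αP + constP v * βP
    σ-β = trans (σP≋ βP) (trans σE.eval-β σβ≋)

    const-inverse : ∀ {a b} → a F.* b F.≈ 1F → constP a * constP b ≋ 1P
    const-inverse ab≈1 = trans (sym (const.*-homo _ _)) (mono-cong 0 0 ab≈1)

    const-opposite : ∀ {a b} → a F.+ b F.≈ 0F → constP a + constP b ≋ 0P
    const-opposite a+b≈0 = trans (sym (const.+-homo _ _)) (trans (mono-cong 0 0 a+b≈0) const.0#-homo)

    τσβ : ∀ {a m n b} x y → a * m ≋ 1P → n + b ≋ 0P → a * (m * (x + n * y)) + b * y ≋ x
    τσβ {a} {m} {n} {b} x y am≈1 n+b≈0 = begin
      a * (m * (x + n * y)) + b * y   ≈⟨ +-congʳ (*-assoc a m _) ⟨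
      (a * m) * (x + n * y) + b * y   ≈⟨ +-congʳ (trans (*-congʳ am≈1) (*-identityˡ _)) ⟩
      (x + n * y) + b * y             ≈⟨ regroup x n y b ⟩
      x + (n + b) * y                 ≈⟨ +-congˡ (trans (*-congʳ n+b≈0) (zeroˡ y)) ⟩
      x + 0P                          ≈⟨ +-identityʳ x ⟩
      x                               ∎
      where regroup = solve 4 (λ x n y b → (x :+ n :* y) :+ b :* y := x :+ (n :+ b) :* y) ≋refl

    στα : ∀ {a m n b} x y → m * a ≋ 1P → n + b ≋ 0P → m * ((a * x + b * y) + n * y) ≋ x
    στα {a} {m} {n} {b} x y ma≈1 n+b≈0 = begin
      m * ((a * x + b * y) + n * y)   ≈⟨ regroup m a x b y n ⟩
      (m * a) * x + m * ((n + b) * y) ≈⟨ +-cong (trans (*-congʳ ma≈1) (*-identityˡ x)) (*-congˡ (trans (*-congʳ n+b≈0) (zeroˡ y))) ⟩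
      x + m * 0P                      ≈⟨ trans (+-congˡ (zeroʳ m)) (+-identityʳ x) ⟩
      x                               ∎
      where
      regroup = solve 6 (λ m a x b y n →
          m :* ((a :* x :+ b :* y) :+ n :* y)
            := (m :* a) :* x :+ m :* ((n :+ b) :* y)) ≋refl

    id-hom : End (λ p → p)
    id-hom = Identity.isRingHomomorphism rawRing ≋refl

  τσ : ∀ p → τP (σP p) ≋ p
  τσ = end-ext (Composition.isRingHomomorphism trans σP-hom τP-hom) id-hom
    (λ a → trans (τH.⟦⟧-cong (σ-const a)) (trans (τE.eval-const (σ a)) (mono-cong 0 0 (σ⁻¹σ a))))
    (trans (τH.⟦⟧-cong σ-α) τE.eval-β)
    (begin
      τP (σP βP)
        ≈⟨ τH.⟦⟧-cong σ-β ⟩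
      τP (constP u * αP + constP v * βP)
        ≈⟨ trans (τH.+-homo _ _) (+-cong (τH.*-homo _ _) (τH.*-homo _ _)) ⟩
      τP (constP u) * τP αP + τP (constP v) * τP βP
        ≈⟨ +-cong (*-cong (τE.eval-const u) τE.eval-α) (*-cong (τE.eval-const v) τE.eval-β) ⟩
      constP (σ⁻¹ u) * τα + constP (σ⁻¹ v) * αP
        ≈⟨ τσβ βP αP (const-inverse (F.trans (F.sym (σ⁻¹.*-homo u u⁻¹)) (F.trans (σ⁻¹.⟦⟧-cong uu⁻¹≈1) σ⁻¹.1#-homo)))
                     (const-opposite (F.-‿inverseˡ (σ⁻¹ v))) ⟩
      βP ∎)

  στ : ∀ p → σP (τP p) ≋ p
  στ = end-ext (Composition.isRingHomomorphism trans τP-hom σP-hom) id-hom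
    (λ a → trans (σH.⟦⟧-cong (τE.eval-const a)) (trans (σ-const (σ⁻¹ a)) (mono-cong 0 0 (σσ⁻¹ a))))
    (begin
      σP (τP αP)
        ≈⟨ σH.⟦⟧-cong τE.eval-α ⟩
      σP τα
        ≈⟨ trans (σH.*-homo _ _) (*-congˡ (trans (σH.+-homo _ _) (+-congˡ (σH.*-homo _ _)))) ⟩
      σP (constP w) * (σP βP + σP (constP (F.- σ⁻¹ v)) * σP αP)
        ≈⟨ *-cong (σ-const w) (+-cong σ-β (*-cong (σ-const _) σ-α)) ⟩
      constP (σ w) * ((constP u * αP + constP v * βP) + constP (σ (F.- σ⁻¹ v)) * βP)
        ≈⟨ στα αP βP
             (const-inverse (F.trans (F.*-congʳ (σσ⁻¹ u⁻¹)) (F.trans (F.*-comm u⁻¹ u) uu⁻¹≈1)))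
             (const-opposite (F.trans (F.+-cong (σ.-‿homo (σ⁻¹ v)) (F.sym (σσ⁻¹ v))) (F.-‿inverseˡ _))) ⟩
      αP ∎)
    (trans (σH.⟦⟧-cong τE.eval-β) σ-α)

  τP-constant : ∀ {p} → Supp (degα< 1) p → Supp (degα< 1) (τP p)
  τP-constant {p} s = supp-resp (sym (trans (τH.⟦⟧-cong (constant-≋ s)) (τE.eval-const _)))
    (supp-mono (s≤s z≤n , s≤s z≤n))

-- Shift products, telescoping and the spread.

module Spread {c ℓ} (F : CommutativeRing c ℓ) (isField : IsField F)
  {σ : CommutativeRing.Carrier F → CommutativeRing.Carrier F} (aut : IsAutomorphism F σ)
  {u v : CommutativeRing.Carrier F} (u≉0 : ¬ CommutativeRing._≈_ F u (CommutativeRing.0# F)) where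
  open Poly2 F
  open Shift σ u v
  open Polynomials F
  open Support F
  open Substitution F
  open OverField F isField
  open ShiftMap F isField aut {u} {v} u≉0
  open CommutativeRing polyRing hiding (_≈_; _≉_; 0#; 1#; zero) renaming (refl to ≋refl)
  open Domains polyRing
  open import Algebra.Solver.Ring.NaturalCoefficients.Default commutativeSemiring using (solve; _:=_; _:*_)
  open import Relation.Binary.Reasoning.Setoid setoid
  private
    module σH = End σP-hom
    module τH = End τP-hom

  -- Splitting off common factors yields a gcd `d`. It cannot be nonconstant, so it is a unit, and
  -- `p` and `q` are associates of coprime polynomials.
  no-gcd⇒coprime : ∀ {p q} → p ≉ 0P → q ≉ 0P → ¬ (Σ Poly λ d → IsGCD d p q × PosDeg d) → ¬ ¬ Coprime p q
  no-gcd⇒coprime p≉0 q≉0 no-gcd = coprime-parts p≉0 q≉0 >>= λ parts →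
    let open CoprimeParts parts
        d≉0 = factor≉0ˡ (sym p≈dx) p≉0
    in coprime-parts⇒gcd p≉0 parts >>= λ gcd →
       LM-exists d≉0 >>= λ (k , n , L) →
       ¬¬-excluded-middle >>= λ where
         (yes constant) → return (coprime-associate (constant-unit constant d≉0) p≈dx q≈dy coprime)
         (no nonconst) → λ _ → no-gcd (d , gcd , LM⇒PosDeg L (nonconstant⇒LM-positive L nonconst))

  -- The equation is pulled back along `τP`, and the cofactor found there is pushed forward along
  -- `σP`.
  σP-coprime : ∀ {x y} → Coprime x y → Coprime (σP x) (σP y)
  σP-coprime {x} {y} coprime e f σxf≈σye =
    let z , xz≈τe = coprime (τP e) (τP f) (begin
          x * τP f             ≈⟨ *-congʳ (τσ x) ⟨
          τP (σP x) * τP f     ≈⟨ τH.*-homo (σP x) f ⟨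
          τP (σP x * f)        ≈⟨ τH.⟦⟧-cong σxf≈σye ⟩
          τP (σP y * e)        ≈⟨ τH.*-homo (σP y) e ⟩
          τP (σP y) * τP e     ≈⟨ *-congʳ (τσ y) ⟩
          y * τP e             ∎)
    in σP z , trans (sym (σH.*-homo x z)) (trans (σH.⟦⟧-cong xz≈τe) (στ e))

  σP-≉0 : ∀ {x} → x ≉ 0P → σP x ≉ 0P
  σP-≉0 {x} x≉0 σx≈0 = x≉0 (trans (sym (τσ x)) (trans (τH.⟦⟧-cong σx≈0) τH.0#-homo))

  σP^-≉0 : ∀ n {x} → x ≉ 0P → σP^ n x ≉ 0P
  σP^-≉0 zero x≉0 = x≉0
  σP^-≉0 (suc n) x≉0 = σP-≉0 (σP^-≉0 n x≉0)

  σP^-nonconstant : ∀ n {x} → ¬ Constant x → ¬ Constant (σP^ n x)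
  σP^-nonconstant zero nonconst = nonconst
  σP^-nonconstant (suc n) nonconst constant =
    σP^-nonconstant n nonconst (supp-resp (τσ _) (τP-constant constant))

  σP^-total : ∀ n {N p} → Supp (Total< N) p → Supp (Total< N) (σP^ n p)
  σP^-total zero s = s
  σP^-total (suc n) s = σP-total (σP^-total n s)

  σP^-* : ∀ n p q → σP^ n (p * q) ≋ σP^ n p * σP^ n q
  σP^-* zero p q = ≋refl
  σP^-* (suc n) p q = trans (σH.⟦⟧-cong (σP^-* n p q)) (σH.*-homo _ _)

  σP^-cong : ∀ n {p q} → p ≋ q → σP^ n p ≋ σP^ n q
  σP^-cong zero e = e
  σP^-cong (suc n) e = σH.⟦⟧-cong (σP^-cong n e)

  σP^-σP : ∀ n p → σP^ n (σP p) ≡ σP (σP^ n p)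
  σP^-σP zero p = refl
  σP^-σP (suc n) p = cong σP (σP^-σP n p)

  shiftProduct : Poly → ℕ → Poly
  shiftProduct p zero = 1P
  shiftProduct p (suc n) = shiftProduct p n * σP^ n p

  shiftProduct-≉0 : ∀ {p} → p ≉ 0P → ∀ n → shiftProduct p n ≉ 0P
  shiftProduct-≉0 p≉0 zero = 1P≉0
  shiftProduct-≉0 p≉0 (suc n) = *-≉0 (shiftProduct-≉0 p≉0 n) (σP^-≉0 n p≉0)

  shiftProduct-coprime : ∀ {x p} → (∀ i → ¬ ¬ Coprime x (σP^ i p)) → ∀ n → ¬ ¬ Coprime x (shiftProduct p n)
  shiftProduct-coprime coprime zero = return coprime-1ʳ
  shiftProduct-coprime coprime (suc n) = shiftProduct-coprime coprime n >>= λ h →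
    coprime n >>= λ h′ → return (coprime-*ʳ h h′)

  shiftProduct-degree : ∀ {p} → p ≉ 0P → ¬ Constant p → ∀ n →
    ¬ ¬ (∃₂ λ k l → LM (shiftProduct p n) k l × n ≤ k ℕ.+ l)
  shiftProduct-degree p≉0 nonconst zero = LM-exists 1P≉0 >>= λ (k , l , L) → return (k , l , L , z≤n)
  shiftProduct-degree p≉0 nonconst (suc n) =
    shiftProduct-degree p≉0 nonconst n >>= λ (k , l , L , n≤) →
    LM-exists (σP^-≉0 n p≉0) >>= λ (k′ , l′ , L′) →
    return (k ℕ.+ k′ , l ℕ.+ l′ , LM-* L L′ ,
      subst (_≤ (k ℕ.+ k′) ℕ.+ (l ℕ.+ l′)) (ℕ.+-comm n 1)
        (subst (n ℕ.+ 1 ≤_) (ℕ-interchange k l k′ l′)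
          (ℕ.+-mono-≤ n≤ (nonconstant⇒LM-positive L′ (σP^-nonconstant n nonconst)))))

  -- σⁿg / g = Pₙ / Qₙ for g = a / b, where Pₙ = p · σp ⋯ σⁿ⁻¹p.
  telescope : ∀ {a b p q} → a ≉ 0P → b ≉ 0P → (σP a * b) * q ≋ (a * σP b) * p → ∀ n →
    ¬ ¬ ((σP^ n a * b) * shiftProduct q n ≋ (a * σP^ n b) * shiftProduct p n)
  telescope a≉0 b≉0 eq zero = return ≋refl
  telescope {a} {b} {p} {q} a≉0 b≉0 eq (suc n) = telescope a≉0 b≉0 eq n >>= λ IH →
    -- The identity for `n` times the σⁿ-image of the hypothesis is the new identity times
    -- `aₙ * bₙ`, which is cancelled.
    regular (*-≉0 (σP^-≉0 n a≉0) (σP^-≉0 n b≉0)) >>= λ reg → return (cancel reg (begin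
      (aₙ * bₙ) * ((aₙ₊₁ * b) * (Q * qₙ))          ≈⟨ regroup₁ aₙ bₙ aₙ₊₁ b Q qₙ ⟩
      ((aₙ * b) * Q) * ((aₙ₊₁ * bₙ) * qₙ)          ≈⟨ *-cong IH shifted ⟩
      ((a * bₙ) * P) * ((aₙ * bₙ₊₁) * pₙ)          ≈⟨ regroup₂ a bₙ P aₙ bₙ₊₁ pₙ ⟩
      (aₙ * bₙ) * ((a * bₙ₊₁) * (P * pₙ))          ∎))
    where
    aₙ = σP^ n a ; bₙ = σP^ n b ; pₙ = σP^ n p ; qₙ = σP^ n q
    aₙ₊₁ = σP^ (suc n) a ; bₙ₊₁ = σP^ (suc n) b
    P = shiftProduct p n ; Q = shiftProduct q n
    regroup₁ = solve 6 (λ a b a′ b′ q q′ →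
        (a :* b) :* ((a′ :* b′) :* (q :* q′))
          := ((a :* b′) :* q) :* ((a′ :* b) :* q′)) ≋refl
    regroup₂ = solve 6 (λ a b p a′ b′ p′ →
        ((a :* b) :* p) :* ((a′ :* b′) :* p′)
          := (a′ :* b) :* ((a :* b′) :* (p :* p′))) ≋refl
    distribute : ∀ x y z → σP^ n ((x * y) * z) ≋ (σP^ n x * σP^ n y) * σP^ n z
    distribute x y z = trans (σP^-* n (x * y) z) (*-congʳ (σP^-* n x y))
    shifted : (aₙ₊₁ * bₙ) * qₙ ≋ (aₙ * bₙ₊₁) * pₙ
    shifted = begin
      (aₙ₊₁ * bₙ) * qₙ           ≈⟨ *-congʳ (*-congʳ (reflexive (σP^-σP n a))) ⟨
      (σP^ n (σP a) * bₙ) * qₙ   ≈⟨ distribute (σP a) b q ⟨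
      σP^ n ((σP a * b) * q)     ≈⟨ σP^-cong n eq ⟩
      σP^ n ((a * σP b) * p)     ≈⟨ distribute a (σP b) p ⟩
      (aₙ * σP^ n (σP b)) * pₙ   ≈⟨ *-congʳ (*-congˡ (reflexive (σP^-σP n b))) ⟩
      (aₙ * bₙ₊₁) * pₙ           ∎

  -- Pₙ divides σⁿ(a) b, whose degree is bounded independently of n.
  coprime-shifts⇒constant : ∀ {a b p q} → a ≉ 0P → b ≉ 0P → p ≉ 0P → q ≉ 0P →
    (σP a * b) * q ≋ (a * σP b) * p → (∀ i j → ¬ ¬ Coprime (σP^ i p) (σP^ j q)) → ¬ ¬ Constant p
  coprime-shifts⇒constant {a} {b} {p} {q} a≉0 b≉0 p≉0 q≉0 eq coprime nonconst =
    (telescope a≉0 b≉0 eq n >>= λ eqₙ →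
     shiftProduct-degree p≉0 nonconst n >>= λ (k , l , L , n≤) →
     regular (shiftProduct-≉0 q≉0 n) >>= λ regQ →
     -- Products are accumulated only on the right of `Coprime`: first the one of the shifts of `q`,
     -- then, after turning the relation round, the one of the shifts of `p`.
     shiftProduct-coprime {shiftProduct q n} {p} (λ i →
       shiftProduct-coprime {σP^ i p} {q} (coprime i) n >>= λ h →
       regular (σP^-≉0 i p≉0) >>= λ reg → return (coprime-sym reg h)) n >>= λ QP →
     let X , PX≈ = coprime-sym regQ QP (σP^ n a * b) (a * σP^ n b) (trans (*-comm _ _) (trans (sym eqₙ) (*-comm _ _)))
         ab≉0 = *-≉0 (σP^-≉0 n a≉0) b≉0
     in LM-exists (factor≉0ʳ PX≈ ab≉0) >>= λ (k′ , l′ , L′) →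
        return (contradict k l k′ l′ n≤ (LM-bound bound (LM-resp PX≈ (LM-* L L′))))) (λ x → x)
    where
    Na = proj₁ (bounded a)
    Nb = proj₁ (bounded b)
    -- The total degree of σⁿ(a) b is below this number for any exponent of σ, while this many
    -- nonconstant factors reach it.
    n = suc (Na ℕ.+ Nb)
    bound : Supp (Total< n) (σP^ n a * b)
    bound = total-* (σP^-total n (supp-⊆ ℕ.m≤n⇒m≤1+n (proj₂ (bounded a)))) (supp-⊆ ℕ.m≤n⇒m≤1+n (proj₂ (bounded b)))
    contradict : ∀ k l k′ l′ → n ≤ k ℕ.+ l → (k ℕ.+ k′) ℕ.+ (l ℕ.+ l′) < n → ⊥
    contradict k l k′ l′ n≤ <n = ℕ.<⇒≱ <n (ℕ.≤-trans n≤ (ℕ.+-mono-≤ (ℕ.m≤m+n k k′) (ℕ.m≤m+n l l′)))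

  Constant⇒IsConstant : ∀ {p} → Constant p → IsConstant p
  Constant⇒IsConstant s i j 0<i+j = s .off i j λ { (s≤s z≤n , s≤s z≤n) → ℕ.<-irrefl refl 0<i+j }

  constants-or-spread : ∀ {a b p q} → a ≉ 0P → b ≉ 0P → q ≉ 0P → (σP a * b) * q ≋ (a * σP b) * p →
    ¬ ¬ ((IsConstant p × IsConstant q) ⊎ SprUnionNonempty p q)
  constants-or-spread {a} {b} {p} {q} a≉0 b≉0 q≉0 eq = ¬¬-excluded-middle >>= λ where
      (yes spread) → return (inj₂ spread)
      (no no-spread) →
        let coprime = pairwise no-spread in
        coprime-shifts⇒constant a≉0 b≉0 p≉0 q≉0 eq coprime >>= λ p-constant →
        -- Passing from g to its inverse exchanges `a` with `b` and `p` with `q`.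
        coprime-shifts⇒constant b≉0 a≉0 q≉0 p≉0
          (trans (*-congʳ (*-comm (σP b) a)) (trans (sym eq) (*-congʳ (*-comm (σP a) b))))
          (λ i j → coprime j i >>= λ h → regular (σP^-≉0 j p≉0) >>= λ reg → return (coprime-sym reg h)) >>= λ q-constant →
        return (inj₁ (Constant⇒IsConstant p-constant , Constant⇒IsConstant q-constant))
    where
    p≉0 : p ≉ 0P
    p≉0 p≈0 = *-≉0 (*-≉0 (σP-≉0 a≉0) b≉0) q≉0 (trans eq (trans (*-congˡ p≈0) (zeroʳ _)))
    -- Peeling off the common power of σ leaves `p` against a shift of `q`, or `q` against a shift
    -- of `p`: exactly the pairs that the two spreads control.
    pairwise : ¬ SprUnionNonempty p q → ∀ i j → ¬ ¬ Coprime (σP^ i p) (σP^ j q)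
    pairwise no-spread zero j = no-gcd⇒coprime p≉0 (σP^-≉0 j q≉0) (λ gcd → no-spread (j , inj₁ gcd))
    pairwise no-spread (suc i) zero =
      no-gcd⇒coprime q≉0 (σP^-≉0 (suc i) p≉0) (λ gcd → no-spread (suc i , inj₂ gcd)) >>= λ h →
      regular q≉0 >>= λ reg → return (coprime-sym reg h)
    pairwise no-spread (suc i) (suc j) = pairwise no-spread i j >>= λ h → return (σP-coprime h)

-- The equation is σ(g) / g = p / q for g = a / b, with denominators cleared. Which alternative
-- holds is settled by excluded middle, hence the double negation.
theorem2p4 : ∀ {c ℓ} (F : CommutativeRing c ℓ) → IsField F →
    (σ : CommutativeRing.Carrier F → CommutativeRing.Carrier F) → IsAutomorphism F σ →
    (u v : CommutativeRing.Carrier F) → ¬ (CommutativeRing._≈_ F u (CommutativeRing.0# F)) →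
    let open CommutativeRing F
        open Poly2 F
        open Shift σ u v
    in (a b p q : Poly) → ¬ (a ≃ 0P) → ¬ (b ≃ 0P) → ¬ (q ≃ 0P) →
       ((σP a *P b) *P q) ≃ ((a *P σP b) *P p) →
       IsGCD 1P p q →
       ¬ ¬ ((IsConstant p × IsConstant q) ⊎ SprUnionNonempty p q)
theorem2p4 F isField σ aut u v u≉0 a b p q a≄0 b≄0 q≄0 eq _ =
  constants-or-spread (λ e → a≄0 (e .at)) (λ e → b≄0 (e .at)) (λ e → q≄0 (e .at))
    (trans (reflexive (·-· (σP a) b q)) (trans (coeffwise eq) (reflexive (≡.sym (·-· a (σP b) p)))))
  where
  open Poly2 F
  open Shift σ u v
  open Polynomials F
  open CommutativeRing polyRing using (trans; reflexive)
  open Spread F isField aut {u} {v} u≉0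
  ·-· : ∀ x y z → (x · y) · z ≡ (x *P y) *P z
  ·-· x y z = ≡.trans (·≡ (x · y) z) (cong (_*P z) (·≡ x y))
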